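{- Let $\mathbb{A}$ be a finite relational structure and let $\mathcal{D}(\mathbb{A})$ be the digraph constructed from $\mathbb{A}$ as in the context. Let $\Sigma$ be a linear idempotent set of identities such that the zigzag satisfies $\Sigma$ (i.e. the algebra of polymorphisms of the zigzag satisfies $\Sigma$) and each identity in $\Sigma$ is either balanced or contains at most two variables. Then $$\mathcal{D}(\mathbb{A})\models\Sigma\quad\text{if and only if}\quad \mathbb{A}\models\Sigma .$$
   Context: A finite relational structure $\mathbb{A}=(A;R_1,\dots,R_n)$ ($n\ge1$) is a finite set $A$ with finitely many nonempty relations $R_i\subseteq A^{k_i}$, $k_i\ge 1$. A digraph is a structure with one binary relation $\to$. Construction of $\mathcal{D}(\mathbb{A})$. Let $k=\sum_i k_i$ and let $R=R_1\times\dots\times R_n\subseteq A^k$ (concatenations of tuples). The single edge is the oriented path $\bullet\to\bullet$ and the zigzag is the oriented path $\bullet\to\bullet\leftarrow\bullet\to\bullet$; an oriented path $\mathbb{P}$ has an initial (first) vertex $\iota\mathbb{P}$ and a terminal (last) vertex $\tau\mathbb{P}$, and the concatenation $\mathbb{P}\dotplus\mathbb{P}'$ is obtained by identifying $\tau\mathbb{P}$ with $\iota\mathbb{P}'$. For $\mathcal{I}\subseteq[k]=\{1,\dots,k\}$ and $l\in[k]$ let $\mathbb{Q}_{\mathcal{I},l}$ be a single edge if $l\in\mathcal{I}$ and a zigzag if $l\notin\mathcal{I}$, and let $\mathbb{Q}_{\mathcal{I}}=(\bullet\to\bullet)\dotplus\mathbb{Q}_{\mathcal{I},1}\dotplus\dots\dotplus\mathbb{Q}_{\mathcal{I},k}\dotplus(\bullet\to\bullet)$.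 For $e=(a,\mathbf{r})\in A\times R$ let $\mathbb{P}_e=\mathbb{Q}_{\{i\,:\,a=r_i\}}$. The digraph $\mathcal{D}(\mathbb{A})$ is obtained from the disjoint union of the vertex sets $A$ and $R$ by adding, for each $e=(a,\mathbf{r})\in A\times R$, a fresh copy of $\mathbb{P}_e$ with $\iota\mathbb{P}_e$ identified with $a$ and $\tau\mathbb{P}_e$ identified with $\mathbf{r}$. A polymorphism of a structure is a finitary operation on its domain that, applied coordinatewise, preserves all its relations. An (operational) signature is a possibly infinite set of operation symbols with finite positive arities; an identity is an expression $u\approx v$ with $u,v$ terms. It is linear if each of $u$ and $v$ contains at most one occurrence of an operation symbol, and balanced if the same set of variables occurs in $u$ and in $v$. A set of identities $\Sigma$ (possibly infinite) is linear if all its identities are linear; it is idempotent if for each operation symbol $f$ appearing in $\Sigma$ the identity $f(x,\dots,x)\approx x$ is in $\Sigma$. A structure $\mathbb{B}$ satisfies $\Sigma$, written $\mathbb{B}\models\Sigma$, if each operation symbol of $\Sigma$ can be interpreted as a polymorphism of $\mathbb{B}$ of the same arity so that all identities of $\Sigma$ hold universally. -}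

module Defs where

open import Level using (Level; _⊔_)
open import Data.Bool.Base using (if_then_else_)
open import Data.Fin.Base using (Fin; zero; suc; inject₁)
open import Data.Fin.Properties using (inj⇒≟)
open import Data.Fin.Relation.Unary.Top using (view; ‵fromℕ; ‵inject₁)
open import Data.Fin.Subset using (Subset; Side)
open import Data.List.Base as List using (List; []; _∷_; [_]; _++_; concatMap)
open import Data.List.Membership.Propositional using () renaming (_∈_ to _∈ˡ_)
open import Data.List.Relation.Binary.BagAndSetEquality using (_∼[_]_; set)
open import Data.List.Relation.Binary.Subset.Propositional using (_⊆_)
open import Data.Nat.Base using (ℕ; zero; suc; _+_; _≤_; NonZero)
open import Data.Product.Base using (_×_; _,_; proj₁; proj₂; ∃; ∃-syntax; ∃₂; Σ-syntax)
open import Data.Refinement using (Refinement-syntax; value)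
open import Data.Unit.Base using (⊤)
open import Data.Vec.Base as Vec using (Vec; []; _∷_; take; drop; transpose; replicate; toList)
open import Data.Vec.Functional as Vector using (Vector)
open import Data.Vec.Relation.Unary.All using (All)
open import Function.Base using (_∘_)
open import Function.Bundles using (_↔_)
open import Function.Properties.Inverse using (↔⇒↣)
open import Relation.Binary.Core using (Rel)
open import Relation.Binary.Definitions using (DecidableEquality)
open import Relation.Binary.PropositionalEquality using (_≡_)
open import Relation.Nullary.Decidable.Core using (does)
open import Relation.Unary using (Pred; _∈_; Decidable; Satisfiable)

------------------------------------------------------------------------
-- Relational structures

record Structure : Set₁ where
  field
    Carrier  : Set
    size     : ℕ
    arity    : Vector ℕ size
    relation : (i : Fin size) → Pred (Vec Carrier (arity i)) Level.zero

-- `relation?` is part of finiteness: a subset of a finite set is itself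
-- finite precisely when membership in it is decidable.
record IsFinite (𝔸 : Structure) : Set where
  open Structure 𝔸
  field
    finite         : ∃[ m ] (Carrier ↔ Fin m)
    relation?      : ∀ i → Decidable (relation i)
    size-nonZero   : NonZero size
    arity-nonZero  : ∀ i → NonZero (arity i)
    nonempty       : ∀ i → Satisfiable (relation i)

  infix 4 _≟_
  _≟_ : DecidableEquality Carrier
  _≟_ = inj⇒≟ (↔⇒↣ (proj₂ finite))

uncurry₂ : ∀ {V : Set} → Rel V Level.zero → Pred (Vec V 2) Level.zero
uncurry₂ _⟶_ (u ∷ v ∷ []) = u ⟶ v

digraph : (V : Set) → Rel V Level.zero → Structure
digraph V _⟶_ = record
  { Carrier  = V
  ; size     = 1
  ; arity    = λ _ → 2
  ; relation = λ _ → uncurry₂ _⟶_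
  }

------------------------------------------------------------------------
-- Oriented paths

data Arrow : Set where
  forward backward : Arrow

-- The vertices of `p` are `Fin (suc (length p))`, from the initial vertex
-- `zero` to the terminal vertex `fromℕ (length p)`; the i-th arrow joins
-- the vertices i and i + 1.  Concatenation of paths is `_++_`.
OrientedPath : Set
OrientedPath = List Arrow

PathVertex : OrientedPath → Set
PathVertex p = Fin (suc (List.length p))

data PathEdge (p : OrientedPath) : Rel (PathVertex p) Level.zero where
  along   : ∀ i → List.lookup p i ≡ forward  → PathEdge p (inject₁ i) (suc i)
  against : ∀ i → List.lookup p i ≡ backward → PathEdge p (suc i) (inject₁ i)

pathDigraph : OrientedPath → Structure
pathDigraph p = digraph (PathVertex p) (PathEdge p)

edge zigzag : OrientedPath
edge   = [ forward ]
zigzag = forward ∷ backward ∷ forward ∷ []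

segment : Side → OrientedPath
segment s = if s then edge else zigzag

-- The middle part of ℚ_I; the l-th entry of `I` is `inside` iff l ∈ I.
core : ∀ {k} → Subset k → OrientedPath
core I = concatMap segment (toList I)

ℚ : ∀ {k} → Subset k → OrientedPath
ℚ I = edge ++ core I ++ edge

------------------------------------------------------------------------
-- The digraph 𝓓(𝔸)

Σarity : ∀ {n} → Vector ℕ n → ℕ
Σarity = Vector.foldr _+_ 0

-- R₁ × … × Rₙ, as a set of concatenated tuples.
Product : ∀ {A : Set} {n} (k : Vector ℕ n) →
          ((i : Fin n) → Pred (Vec A (k i)) Level.zero) →
          Pred (Vec A (Σarity k)) Level.zero
Product {n = zero}  k R r = ⊤
Product {n = suc n} k R r =
  R zero (take (k zero) r) × Product (k ∘ suc) (R ∘ suc) (drop (k zero) r)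

module Construction (𝔸 : Structure) (fin : IsFinite 𝔸) where
  open Structure 𝔸
  open IsFinite fin

  -- Membership is irrelevant here, so that elements are equal as soon as
  -- the underlying tuples are.
  Tuple : Set
  Tuple = [ r ∈ Vec Carrier (Σarity arity) ∣ Product arity relation r ]

  agreement : Carrier → Tuple → Subset (Σarity arity)
  agreement a r = Vec.map (λ b → does (a ≟ b)) (value r)

  ℙ : Carrier → Tuple → OrientedPath
  ℙ a r = ℚ (agreement a r)

  -- As `ℚ I` reduces to `forward ∷ core I ++ edge`, a path ℙ a r has
  -- `length (core (agreement a r) ++ edge)` vertices other than its two ends.
  data Vertex : Set where
    element : Carrier → Vertex
    tuple   : Tuple → Vertex
    inner   : ∀ a r → Fin (List.length (core (agreement a r) ++ edge)) → Vertex

  place : ∀ a r → PathVertex (ℙ a r) → Vertex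
  place a r zero = element a
  place a r (suc j) with view j
  ... | ‵fromℕ     = tuple r
  ... | ‵inject₁ i = inner a r i

  _⟶_ : Rel Vertex Level.zero
  u ⟶ v = ∃₂ λ a r → ∃₂ λ x y →
    PathEdge (ℙ a r) x y × u ≡ place a r x × v ≡ place a r y

𝓓 : (𝔸 : Structure) → IsFinite 𝔸 → Structure
𝓓 𝔸 fin = digraph Vertex _⟶_
  where open Construction 𝔸 fin

------------------------------------------------------------------------
-- Polymorphisms

Operation : ℕ → Set → Set
Operation m A = Vec A m → A

IsPolymorphism : (𝔹 : Structure) → ∀ {m} → Operation m (Structure.Carrier 𝔹) → Set
IsPolymorphism 𝔹 {m} f =
  ∀ i (rs : Vec (Vec Carrier (arity i)) m) →
  All (relation i) rs → relation i (Vec.map f (transpose rs))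
  where open Structure 𝔹

------------------------------------------------------------------------
-- Terms and identities

record Signature s : Set (Level.suc s) where
  field
    Symbol          : Set s
    symbolArity     : Symbol → ℕ
    arityPositive   : ∀ f → NonZero (symbolArity f)

module _ {s} (𝑆 : Signature s) where
  open Signature 𝑆

  data Term : Set s where
    var : ℕ → Term
    op  : (f : Symbol) → Vec Term (symbolArity f) → Term

  infix 4 _≈_
  record Identity : Set s where
    constructor _≈_
    field
      lhs rhs : Term

module _ {s} {𝑆 : Signature s} where
  open Signature 𝑆

  vars  : Term 𝑆 → List ℕ
  varsᵛ : ∀ {n} → Vec (Term 𝑆) n → List ℕ
  vars (var x)     = [ x ]
  vars (op f ts)   = varsᵛ ts
  varsᵛ []         = []
  varsᵛ (t ∷ ts)   = vars t ++ varsᵛ ts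

  -- Occurrences of operation symbols, with multiplicity.
  symbols  : Term 𝑆 → List Symbol
  symbolsᵛ : ∀ {n} → Vec (Term 𝑆) n → List Symbol
  symbols (var x)     = []
  symbols (op f ts)   = f ∷ symbolsᵛ ts
  symbolsᵛ []         = []
  symbolsᵛ (t ∷ ts)   = symbols t ++ symbolsᵛ ts

  LinearIdentity : Pred (Identity 𝑆) _
  LinearIdentity (u ≈ v) = List.length (symbols u) ≤ 1 × List.length (symbols v) ≤ 1

  Balanced : Pred (Identity 𝑆) _
  Balanced (u ≈ v) = vars u ∼[ set ] vars v

  AtMostTwoVariables : Pred (Identity 𝑆) _
  AtMostTwoVariables (u ≈ v) = ∃₂ λ x y → vars u ++ vars v ⊆ (x ∷ y ∷ [])

  module _ {ℓ} (Σ : Pred (Identity 𝑆) ℓ) where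

    Linear : Set (s ⊔ ℓ)
    Linear = ∀ e → e ∈ Σ → LinearIdentity e

    AppearsIn : Symbol → Set (s ⊔ ℓ)
    AppearsIn f = ∃₂ λ u v → (u ≈ v) ∈ Σ × f ∈ˡ symbols u ++ symbols v

    Idempotent : Set (s ⊔ ℓ)
    Idempotent = ∀ f → AppearsIn f →
      ∃[ x ] (op f (replicate (symbolArity f) (var x)) ≈ var x) ∈ Σ

  module _ {A : Set} (⟦_⟧ : (f : Symbol) → Operation (symbolArity f) A) (ρ : ℕ → A) where

    eval  : Term 𝑆 → A
    evalᵛ : ∀ {n} → Vec (Term 𝑆) n → Vec A n
    eval (var x)     = ρ x
    eval (op f ts)   = ⟦ f ⟧ (evalᵛ ts)
    evalᵛ []         = []
    evalᵛ (t ∷ ts)   = eval t ∷ evalᵛ ts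

  -- Every symbol of the signature is interpreted, including those that do
  -- not appear in Σ; as arities are positive, the latter can always be
  -- interpreted by projections.
  infix 4 _⊨_
  _⊨_ : ∀ {ℓ} → Structure → Pred (Identity 𝑆) ℓ → Set (s ⊔ ℓ)
  𝔹 ⊨ Σ = Σ[ ⟦_⟧ ∈ ((f : Symbol) → Operation (symbolArity f) Carrier) ]
    (∀ f → IsPolymorphism 𝔹 ⟦ f ⟧) ×
    (∀ u v → (u ≈ v) ∈ Σ → ∀ ρ → eval ⟦_⟧ ρ u ≡ eval ⟦_⟧ ρ v)
    where open Structure 𝔹

-- Every vertex of 𝓓(𝔸) has a height between 0 and k + 2, and ℚ ∅ maps onto every
-- path ℙ a r.  A polymorphism of 𝓓(𝔸) sends a family of copies of ℚ ∅ to an image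
-- of ℚ ∅ whose heights are forced, hence it acts on A and on R; it preserves the
-- relation a = r_l because that holds iff the l-th segment of ℙ a r is a single
-- edge.  So it restricts to a polymorphism of 𝔸.
--
-- Conversely, let f act on A and on the zigzag.  Tuples whose entries have equal
-- height and do not contain both a peak and a valley are sent into ℙ (f a) (f r),
-- to the position computed by f on the zigzag.  For the other tuples the entries
-- are split into the lowest ones and the rest, coded by the vertices 0 and 2 of
-- the zigzag, and f on the zigzag decides whether the result is the first of the
-- lowest entries, in the order by (a, r), or the first of the highest ones, in
-- the order by (r, a); this respects edges because in a path of such tuples of
-- unequal heights the lowest entries never reach R and the highest never reach A.
-- Apart from the operations f, everything depends on the set of entries only,
-- which gives the balanced identities; an unbalanced identity in two variables
-- makes both of its sides projections, and projections are preserved.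
module Submission where

open import Defs
open import Level using (0ℓ)
open import Data.Bool.Base using (Bool; true; false; if_then_else_)
open import Data.Fin.Base as Fin using (Fin; zero; suc; inject₁; fromℕ)
open import Data.Fin.Properties as Fin using ()
open import Data.Fin.Relation.Unary.Top using (view; view-fromℕ; view-inject₁; ‵fromℕ; ‵inject₁)
open import Data.Fin.Subset using (Side; inside; outside)
open import Data.Irrelevant using ([_])
open import Data.List.Base as List using (List; []; _∷_; _++_; filter)
open import Data.List.Extrema.Nat using (argmin; argmax; argmin-sel; argmax-sel;
  f[argmin]≤f[⊤]; f[argmin]≤f[xs]; f[⊥]≤f[argmax]; f[xs]≤f[argmax])
open import Data.List.Membership.Propositional using (find; lose) renaming (_∈_ to _∈ˡ_)
open import Data.List.Membership.Propositional.Properties using (∈-filter⁺; ∈-filter⁻;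
  ∈-map⁺; ∈-allFin; ∈-++⁺ˡ; ∈-++⁺ʳ; ∈-upTo⁺; ∈-cartesianProduct⁺; ∈-cartesianProductWith⁺)
open import Data.List.Properties using (filter-≐)
open import Data.List.Relation.Binary.Subset.Propositional using (_⊆_)
open import Data.List.Relation.Unary.All as Allˡ using ()
open import Data.List.Relation.Unary.Any using (Any; any?; here; there)
open import Data.Nat.Base using (ℕ; zero; suc; _+_; _∸_; _≤_; _<_; z≤n; s≤s; >-nonZero⁻¹)
import Data.Nat.Properties as ℕ
open import Data.Product.Base using (_×_; _,_; proj₁; proj₂; ∃; ∃-syntax)
open import Data.Refinement as Refinement using (Refinement-syntax; _,_; value; value-injective)
open import Data.Sum.Base as Sum using (_⊎_; inj₁; inj₂; [_,_]′)
open import Data.Unit.Base using (tt)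
open import Data.Vec.Functional using (Vector)
open import Data.Vec.Base as Vec using (Vec; []; _∷_; lookup; map; transpose; replicate; toList)
import Data.Vec.Properties as Vec
open import Data.Vec.Membership.Propositional.Properties using (∈-lookup; ∈-toList⁺; ∈-toList⁻)
open import Data.Vec.Relation.Unary.Any.Properties using (lookup-index)
open import Data.Vec.Relation.Unary.All as All using (All; []; _∷_)
open import Data.Vec.Relation.Unary.All.Properties as All using ()
open import Function.Base using (_∘_; id)
open import Function.Bundles using (_⇔_; Equivalence; Inverse; mk⇔)
open import Relation.Binary.Core using (Rel)
open import Relation.Binary.Definitions using (DecidableEquality)
open import Relation.Binary.PropositionalEquality
open import Relation.Nullary using (¬_; Dec; yes; no; contradiction)
open import Relation.Nullary.Decidable using (_×-dec_; map′; does; dec-true; dec-false; recompute)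
open import Relation.Unary using (Pred; _∈_; Decidable)

-- Coordinates on oriented paths

-- A level of a path has at most three vertices: the joint between two segments, the peak of a
-- zigzag ending there and the valley of a zigzag starting there. Height and kind thus locate a
-- vertex.
data Kind : Set where
  joint peak valley : Kind

data Lower : Pred Kind 0ℓ where
  joint  : Lower joint
  valley : Lower valley

data Upper : Pred Kind 0ℓ where
  joint : Upper joint
  peak  : Upper peak

-- The arrows of a segment; the zigzag is joint → peak ← valley → joint.
data Arc : Side → Rel Kind 0ℓ where
  straight : Arc inside joint joint
  rise     : Arc outside joint peak
  fall     : Arc outside valley peak
  climb    : Arc outside valley joint

lower : ∀ {s κ κ′} → Arc s κ κ′ → Lower κ
lower straight = joint
lower rise     = joint
lower fall     = valley
lower climb    = valley

upper : ∀ {s κ κ′} → Arc s κ κ′ → Upper κ′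
upper straight = joint
upper rise     = peak
upper fall     = peak
upper climb    = joint

-- ℚ I reduces to path (inside ∷ I).
path : ∀ {n} → Vec Side n → OrientedPath
path I = core I ++ edge

-- Concerns the segment between the levels h and h + 1. The closing edge of `path I` is not listed
-- in `I`, hence the default.
side : ∀ {n} → Vec Side n → ℕ → Side
side []      _       = inside
side (s ∷ _) zero    = s
side (_ ∷ I) (suc h) = side I h

height : ∀ {n} (I : Vec Side n) → PathVertex (path I) → ℕ
height []            zero                = 0
height []            (suc _)             = 1
height (inside ∷ I)  zero                = 0
height (inside ∷ I)  (suc x)             = suc (height I x)
height (outside ∷ I) zero                = 0
height (outside ∷ I) (suc zero)          = 1
height (outside ∷ I) (suc (suc zero))    = 0
height (outside ∷ I) (suc (suc (suc x))) = suc (height I x)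

kind : ∀ {n} (I : Vec Side n) → PathVertex (path I) → Kind
kind []            _                   = joint
kind (inside ∷ I)  zero                = joint
kind (inside ∷ I)  (suc x)             = kind I x
kind (outside ∷ I) zero                = joint
kind (outside ∷ I) (suc zero)          = peak
kind (outside ∷ I) (suc (suc zero))    = valley
kind (outside ∷ I) (suc (suc (suc x))) = kind I x

-- Where the segment is a single edge, its valley and its peak collapse to the
-- bottom and the top joint: this is the homomorphism from ℚ ∅.
vertexAt : ∀ {n} (I : Vec Side n) → ℕ → Kind → PathVertex (path I)
vertexAt []            zero          _      = zero
vertexAt []            (suc _)       _      = suc zero
vertexAt (inside ∷ I)  zero          _      = zero
vertexAt (inside ∷ I)  (suc h)       κ      = suc (vertexAt I h κ)
vertexAt (outside ∷ I) zero          joint  = zero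
vertexAt (outside ∷ I) zero          peak   = zero
vertexAt (outside ∷ I) zero          valley = suc (suc zero)
vertexAt (outside ∷ I) (suc zero)    joint  = suc (suc (suc (vertexAt I zero joint)))
vertexAt (outside ∷ I) (suc zero)    peak   = suc zero
vertexAt (outside ∷ I) (suc zero)    valley = suc (suc (suc (vertexAt I zero valley)))
vertexAt (outside ∷ I) (suc (suc h)) κ      = suc (suc (suc (vertexAt I (suc h) κ)))

skip-zigzag : ∀ {n} → Fin n → Fin (3 + n)
skip-zigzag x = suc (suc (suc x))

height-zero : ∀ {n} (I : Vec Side n) → height I zero ≡ 0
height-zero []            = refl
height-zero (inside ∷ _)  = refl
height-zero (outside ∷ _) = refl

kind-zero : ∀ {n} (I : Vec Side n) → kind I zero ≡ joint
kind-zero []            = refl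
kind-zero (inside ∷ _)  = refl
kind-zero (outside ∷ _) = refl

height-fromℕ : ∀ {n} (I : Vec Side n) → height I (fromℕ _) ≡ suc n
height-fromℕ []            = refl
height-fromℕ (inside ∷ I)  = cong suc (height-fromℕ I)
height-fromℕ (outside ∷ I) = cong suc (height-fromℕ I)

kind-fromℕ : ∀ {n} (I : Vec Side n) → kind I (fromℕ _) ≡ joint
kind-fromℕ []            = refl
kind-fromℕ (inside ∷ I)  = kind-fromℕ I
kind-fromℕ (outside ∷ I) = kind-fromℕ I

height≤ : ∀ {n} (I : Vec Side n) x → height I x ≤ suc n
height≤ []            zero                = z≤n
height≤ []            (suc _)             = s≤s z≤n
height≤ (inside ∷ I)  zero                = z≤n
height≤ (inside ∷ I)  (suc x)             = s≤s (height≤ I x)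
height≤ (outside ∷ I) zero                = z≤n
height≤ (outside ∷ I) (suc zero)          = s≤s z≤n
height≤ (outside ∷ I) (suc (suc zero))    = z≤n
height≤ (outside ∷ I) (suc (suc (suc x))) = s≤s (height≤ I x)

vertexAt-zero : ∀ {n} (I : Vec Side n) {κ} → Upper κ → vertexAt I 0 κ ≡ zero
vertexAt-zero []            _     = refl
vertexAt-zero (inside ∷ _)  _     = refl
vertexAt-zero (outside ∷ _) joint = refl
vertexAt-zero (outside ∷ _) peak  = refl

vertexAt-top : ∀ {n} (I : Vec Side n) κ → vertexAt I (suc n) κ ≡ fromℕ _
vertexAt-top []            κ = refl
vertexAt-top (inside ∷ I)  κ = cong suc (vertexAt-top I κ)
vertexAt-top (outside ∷ I) κ = cong skip-zigzag (vertexAt-top I κ)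

vertexAt-valley : ∀ {n} (I : Vec Side n) h → side I h ≡ inside →
                  vertexAt I h valley ≡ vertexAt I h joint
vertexAt-valley []            zero          _  = refl
vertexAt-valley []            (suc h)       _  = refl
vertexAt-valley (inside ∷ I)  zero          _  = refl
vertexAt-valley (inside ∷ I)  (suc h)       eq = cong suc (vertexAt-valley I h eq)
vertexAt-valley (outside ∷ I) zero          ()
vertexAt-valley (outside ∷ I) (suc zero)    eq = cong skip-zigzag (vertexAt-valley I 0 eq)
vertexAt-valley (outside ∷ I) (suc (suc h)) eq = cong skip-zigzag (vertexAt-valley I (suc h) eq)

vertexAt-peak : ∀ {n} (I : Vec Side n) h → side I h ≡ inside →
                vertexAt I (suc h) peak ≡ vertexAt I (suc h) joint
vertexAt-peak []            h       _  = refl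
vertexAt-peak (inside ∷ I)  zero    _  =
  cong suc (trans (vertexAt-zero I peak) (sym (vertexAt-zero I joint)))
vertexAt-peak (inside ∷ I)  (suc h) eq = cong suc (vertexAt-peak I h eq)
vertexAt-peak (outside ∷ I) zero    ()
vertexAt-peak (outside ∷ I) (suc h) eq = cong skip-zigzag (vertexAt-peak I h eq)

-- A peak lies above a zigzag. This keeps `vertexAt-height-kind` away from the junk value of
-- `vertexAt` for a peak at level 0.
peak⇒height≢0 : ∀ {n} (I : Vec Side n) x → kind I x ≡ peak → height I x ≢ 0
peak⇒height≢0 []            x                   ()
peak⇒height≢0 (inside ∷ I)  zero                ()
peak⇒height≢0 (inside ∷ I)  (suc x)             _  ()
peak⇒height≢0 (outside ∷ I) zero                ()
peak⇒height≢0 (outside ∷ I) (suc zero)          _  ()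
peak⇒height≢0 (outside ∷ I) (suc (suc zero))    ()
peak⇒height≢0 (outside ∷ I) (suc (suc (suc x))) _  ()

vertexAt-height-kind : ∀ {n} (I : Vec Side n) x → vertexAt I (height I x) (kind I x) ≡ x
vertexAt-height-kind []            zero             = refl
vertexAt-height-kind []            (suc zero)       = refl
vertexAt-height-kind (inside ∷ I)  zero             = refl
vertexAt-height-kind (inside ∷ I)  (suc x)          = cong suc (vertexAt-height-kind I x)
vertexAt-height-kind (outside ∷ I) zero             = refl
vertexAt-height-kind (outside ∷ I) (suc zero)       = refl
vertexAt-height-kind (outside ∷ I) (suc (suc zero)) = refl
vertexAt-height-kind (outside ∷ I) (suc (suc (suc x)))
  with height I x | kind I x | vertexAt-height-kind I x | peak⇒height≢0 I x
... | zero  | joint  | eq | _  = cong skip-zigzag eq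
... | zero  | peak   | _  | ne = contradiction refl (ne refl)
... | zero  | valley | eq | _  = cong skip-zigzag eq
... | suc h | κ      | eq | _  = cong skip-zigzag eq

record Climbs {n} (I : Vec Side n) (x y : PathVertex (path I)) : Set where
  constructor climbs
  field
    rises : height I y ≡ suc (height I x)
    below : height I x ≤ n
    arc   : Arc (side I (height I x)) (kind I x) (kind I y)

climbs-there : ∀ {n} s (I : Vec Side n) {x y} → Climbs I x y →
               ∀ {x′ y′} → height (s ∷ I) x′ ≡ suc (height I x) → kind (s ∷ I) x′ ≡ kind I x →
               height (s ∷ I) y′ ≡ suc (height I y) → kind (s ∷ I) y′ ≡ kind I y →
               Climbs (s ∷ I) x′ y′
climbs-there s I {x} (climbs r b a) hx kx hy ky = climbs
  (trans hy (cong suc (trans r (sym hx))))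
  (subst (_≤ _) (sym hx) (s≤s b))
  (subst₂ (Arc (side (s ∷ I) (height (s ∷ I) _))) (sym kx) (sym ky)
    (subst (λ h → Arc (side (s ∷ I) h) (kind I x) (kind I _)) (sym hx) a))

edge⇒climbs : ∀ {n} (I : Vec Side n) {x y} → PathEdge (path I) x y → Climbs I x y
edge⇒climbs [] (along zero _) = climbs refl z≤n straight
edge⇒climbs [] (against zero ())
edge⇒climbs (inside ∷ I) (along zero _) = climbs (cong suc (height-zero I)) z≤n
  (subst (Arc inside joint) (sym (kind-zero I)) straight)
edge⇒climbs (inside ∷ I) (along (suc i) eq) =
  climbs-there inside I (edge⇒climbs I (along i eq)) refl refl refl refl
edge⇒climbs (inside ∷ I) (against zero ())
edge⇒climbs (inside ∷ I) (against (suc i) eq) =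
  climbs-there inside I (edge⇒climbs I (against i eq)) refl refl refl refl
edge⇒climbs (outside ∷ I) (along zero _) = climbs refl z≤n rise
edge⇒climbs (outside ∷ I) (along (suc zero) ())
edge⇒climbs (outside ∷ I) (along (suc (suc zero)) _) = climbs (cong suc (height-zero I)) z≤n
  (subst (Arc outside valley) (sym (kind-zero I)) climb)
edge⇒climbs (outside ∷ I) (along (suc (suc (suc i))) eq) =
  climbs-there outside I (edge⇒climbs I (along i eq)) refl refl refl refl
edge⇒climbs (outside ∷ I) (against zero ())
edge⇒climbs (outside ∷ I) (against (suc zero) _) = climbs refl z≤n fall
edge⇒climbs (outside ∷ I) (against (suc (suc zero)) ())
edge⇒climbs (outside ∷ I) (against (suc (suc (suc i))) eq) =
  climbs-there outside I (edge⇒climbs I (against i eq)) refl refl refl refl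

inside-there : ∀ {n} (I : Vec Side n) {x y} → PathEdge (path I) x y →
               PathEdge (path (inside ∷ I)) (suc x) (suc y)
inside-there I (along i eq)   = along (suc i) eq
inside-there I (against i eq) = against (suc i) eq

outside-there : ∀ {n} (I : Vec Side n) {x y} → PathEdge (path I) x y →
                PathEdge (path (outside ∷ I)) (suc (suc (suc x))) (suc (suc (suc y)))
outside-there I (along i eq)   = along (suc (suc (suc i))) eq
outside-there I (against i eq) = against (suc (suc (suc i))) eq

-- Over a single edge all lower kinds collapse to the bottom joint and all upper kinds to the top
-- one, so an arc is demanded over a zigzag only.
arc⇒edge : ∀ {n} (I : Vec Side n) h {κ κ′} → h ≤ n → Lower κ → Upper κ′ →
           (side I h ≡ outside → Arc outside κ κ′) →
           PathEdge (path I) (vertexAt I h κ) (vertexAt I (suc h) κ′)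
arc⇒edge []            zero          h≤n  l u a = along zero refl
arc⇒edge (inside ∷ I)  zero          h≤n  l u a
  rewrite vertexAt-zero I u = along zero refl
arc⇒edge (inside ∷ I)  (suc h)       (s≤s h≤n) l u a = inside-there I (arc⇒edge I h h≤n l u a)
arc⇒edge (outside ∷ I) zero          h≤n  l u a with a refl
... | rise  = along zero refl
... | fall  = against (suc zero) refl
... | climb rewrite vertexAt-zero I joint = along (suc (suc zero)) refl
-- A peak at level 1 would belong to the zigzag just passed; a joint or a valley is found in the
-- rest of the path.
arc⇒edge (outside ∷ I) (suc zero)    (s≤s h≤n) joint  u a = outside-there I (arc⇒edge I 0 h≤n joint u a)
arc⇒edge (outside ∷ I) (suc zero)    (s≤s h≤n) valley u a = outside-there I (arc⇒edge I 0 h≤n valley u a)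
arc⇒edge (outside ∷ I) (suc (suc h)) (s≤s h≤n) l      u a = outside-there I (arc⇒edge I (suc h) h≤n l u a)

-- Vectors of tuples

lookup-ext : ∀ {A : Set} {n} {xs ys : Vec A n} →
             (∀ i → lookup xs i ≡ lookup ys i) → xs ≡ ys
lookup-ext {xs = xs} {ys} eq = trans (sym (Vec.tabulate∘lookup xs))
  (trans (Vec.tabulate-cong eq) (Vec.tabulate∘lookup ys))

lookup-transpose : ∀ {A : Set} {m n} (rs : Vec (Vec A n) m) l →
                   lookup (transpose rs) l ≡ map (λ r → lookup r l) rs
lookup-transpose []       l = Vec.lookup-replicate l []
lookup-transpose {A} {suc m} {n} (r ∷ rs) l = begin
  lookup ((replicate n cons Vec.⊛ r) Vec.⊛ transpose rs) l
    ≡⟨ Vec.lookup-⊛ l (replicate n cons Vec.⊛ r) (transpose rs) ⟩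
  lookup (replicate n cons Vec.⊛ r) l (lookup (transpose rs) l)
    ≡⟨ cong (λ f → f (lookup (transpose rs) l)) (Vec.lookup-⊛ l (replicate n cons) r) ⟩
  lookup (replicate n cons) l (lookup r l) (lookup (transpose rs) l)
    ≡⟨ cong (λ f → f (lookup r l) (lookup (transpose rs) l)) (Vec.lookup-replicate l cons) ⟩
  lookup r l ∷ lookup (transpose rs) l
    ≡⟨ cong (lookup r l ∷_) (lookup-transpose rs l) ⟩
  lookup r l ∷ map (λ r → lookup r l) rs ∎
  where
  open ≡-Reasoning
  cons : A → Vec A m → Vec A (suc m)
  cons = _∷_

infixl 6 _✴_
_✴_ : ∀ {A : Set} {m n} → Operation m A → Vec (Vec A n) m → Vec A n
f ✴ rs = map f (transpose rs)

lookup-✴ : ∀ {A : Set} {m n} (f : Operation m A) (rs : Vec (Vec A n) m) l →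
           lookup (f ✴ rs) l ≡ f (map (λ r → lookup r l) rs)
lookup-✴ f rs l = trans (Vec.lookup-map l f (transpose rs)) (cong f (lookup-transpose rs l))

lookup-take : ∀ {A : Set} m {n} (r : Vec A (m + n)) j →
              lookup (Vec.take m r) j ≡ lookup r (j Fin.↑ˡ n)
lookup-take m r j = trans (sym (Vec.lookup-++ˡ (Vec.take m r) (Vec.drop m r) j))
  (cong (λ r → lookup r _) (Vec.take++drop≡id m r))

lookup-drop : ∀ {A : Set} m {n} (r : Vec A (m + n)) j →
              lookup (Vec.drop m r) j ≡ lookup r (m Fin.↑ʳ j)
lookup-drop m r j = trans (sym (Vec.lookup-++ʳ (Vec.take m r) (Vec.drop m r) j))
  (cong (λ r → lookup r _) (Vec.take++drop≡id m r))

module _ {A : Set} where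

  -- `Product` peels off factors by nested `take` and `drop`. Naming the i-th block turns membership
  -- into a statement about each i separately.
  block : ∀ {n} (k : Vector ℕ n) i → Vec A (Σarity k) → Vec A (k i)
  block k zero    r = Vec.take (k zero) r
  block k (suc i) r = block (k ∘ suc) i (Vec.drop (k zero) r)

  offset : ∀ {n} (k : Vector ℕ n) i → Fin (k i) → Fin (Σarity k)
  offset k zero    j = j Fin.↑ˡ _
  offset k (suc i) j = k zero Fin.↑ʳ offset (k ∘ suc) i j

  lookup-block : ∀ {n} (k : Vector ℕ n) i r j → lookup (block k i r) j ≡ lookup r (offset k i j)
  lookup-block k zero    r j = lookup-take (k zero) r j
  lookup-block k (suc i) r j = trans (lookup-block (k ∘ suc) i (Vec.drop (k zero) r) j)
    (lookup-drop (k zero) r _)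

  block-✴ : ∀ {n m} (k : Vector ℕ n) i (f : Operation m A) rs →
            block k i (f ✴ rs) ≡ f ✴ map (block k i) rs
  block-✴ k i f rs = lookup-ext λ j → begin
    lookup (block k i (f ✴ rs)) j                    ≡⟨ lookup-block k i (f ✴ rs) j ⟩
    lookup (f ✴ rs) (offset k i j)                   ≡⟨ lookup-✴ f rs _ ⟩
    f (map (λ r → lookup r (offset k i j)) rs)       ≡⟨ cong f (Vec.map-cong (λ r → sym (lookup-block k i r j)) rs) ⟩
    f (map (λ r → lookup (block k i r) j) rs)        ≡⟨ cong f (Vec.map-∘ (λ r → lookup r j) (block k i) rs) ⟩
    f (map (λ r → lookup r j) (map (block k i) rs))  ≡⟨ lookup-✴ f (map (block k i) rs) j ⟨
    lookup (f ✴ map (block k i) rs) j                ∎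
    where open ≡-Reasoning

  join : ∀ {n} (k : Vector ℕ n) → (∀ i → Vec A (k i)) → Vec A (Σarity k)
  join {zero}  k vs = []
  join {suc n} k vs = vs zero Vec.++ join (k ∘ suc) (vs ∘ suc)

  block-join : ∀ {n} (k : Vector ℕ n) vs i → block k i (join k vs) ≡ vs i
  block-join k vs zero    =
    Vec.++-injectiveˡ (Vec.take (k zero) (join k vs)) (vs zero) (Vec.take++drop≡id (k zero) _)
  block-join k vs (suc i) = trans
    (cong (block (k ∘ suc) i)
      (Vec.++-injectiveʳ (Vec.take (k zero) (join k vs)) (vs zero) (Vec.take++drop≡id (k zero) _)))
    (block-join (k ∘ suc) (vs ∘ suc) i)

  product⁻ : ∀ {n} (k : Vector ℕ n) {R : (i : Fin n) → Pred (Vec A (k i)) 0ℓ} {r} →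
             Product k R r → ∀ i → R i (block k i r)
  product⁻ k (p , _) zero    = p
  product⁻ k (_ , q) (suc i) = product⁻ (k ∘ suc) q i

  product⁺ : ∀ {n} (k : Vector ℕ n) {R : (i : Fin n) → Pred (Vec A (k i)) 0ℓ} {r} →
             (∀ i → R i (block k i r)) → Product k R r
  product⁺ {zero}  k p = tt
  product⁺ {suc n} k p = p zero , product⁺ (k ∘ suc) (p ∘ suc)

  product? : ∀ {n} (k : Vector ℕ n) {R : (i : Fin n) → Pred (Vec A (k i)) 0ℓ} →
             (∀ i → Decidable (R i)) → Decidable (Product k R)
  product? {zero}  k R? r = yes tt
  product? {suc n} k R? r =
    R? zero (Vec.take (k zero) r) ×-dec product? (k ∘ suc) (R? ∘ suc) (Vec.drop (k zero) r)

-- Coordinates on 𝓓(𝔸)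

side-lookup : ∀ {n} (I : Vec Side n) l → side I (Fin.toℕ l) ≡ lookup I l
side-lookup (_ ∷ _) zero    = refl
side-lookup (_ ∷ I) (suc l) = side-lookup I l

side-outside : ∀ {n} (I : Vec Side n) h → side I h ≡ outside →
               ∃[ l ] Fin.toℕ l ≡ h × lookup I l ≡ outside
side-outside []      h       ()
side-outside (_ ∷ _) zero    eq = zero , refl , eq
side-outside (_ ∷ I) (suc h) eq =
  let l , l≡h , eq′ = side-outside I h eq in suc l , cong suc l≡h , eq′

does⁻-yes : ∀ {p} {P : Set p} (P? : Dec P) → does P? ≡ true → P
does⁻-yes (yes p) _ = p

does⁻-no : ∀ {p} {P : Set p} (P? : Dec P) → does P? ≡ false → ¬ P
does⁻-no (no ¬p) _ = ¬p

module Coordinates (𝔸 : Structure) (fin : IsFinite 𝔸) where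
  open Structure 𝔸 public
  open IsFinite fin public
  open Construction 𝔸 fin public

  K : ℕ
  K = Σarity arity

  sides : Carrier → Tuple → Vec Side (suc K)
  sides a r = inside ∷ agreement a r

  entry : Fin K → Tuple → Carrier
  entry l r = lookup (value r) l

  -- The stored proof is irrelevant, but the relations are decidable, so a usable one can be
  -- recomputed.
  tuple-∈ : ∀ r → Product arity relation (value r)
  tuple-∈ (r , [ p ]) = recompute (product? arity relation? r) p

  witness : Tuple
  witness = join arity (λ i → proj₁ (nonempty i)) ,
    [ product⁺ arity (λ i → subst (relation i) (sym (block-join arity _ i)) (proj₂ (nonempty i))) ]

  point : Carrier
  point = entry (offset {Carrier} arity i (Fin.fromℕ< (>-nonZero⁻¹ _ {{arity-nonZero i}}))) witness
    where i = Fin.fromℕ< (>-nonZero⁻¹ _ {{size-nonZero}})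

  agreement-outside : ∀ a r l → lookup (agreement a r) l ≡ outside → a ≢ entry l r
  agreement-outside a r l eq =
    does⁻-no (a ≟ entry l r) (trans (sym (Vec.lookup-map l _ (value r))) eq)

  agreement-inside : ∀ a r l → lookup (agreement a r) l ≡ inside → a ≡ entry l r
  agreement-inside a r l eq =
    does⁻-yes (a ≟ entry l r) (trans (sym (Vec.lookup-map l _ (value r))) eq)

  node : Carrier → Tuple → ℕ → Kind → Vertex
  node a r h κ = place a r (vertexAt (sides a r) h κ)

  -- Fillers for the coordinates that a vertex in A or in R lacks.
  elementOf : Vertex → Carrier
  elementOf (element a)   = a
  elementOf (tuple _)     = point
  elementOf (inner a _ _) = a

  tupleOf : Vertex → Tuple
  tupleOf (element _)   = witness
  tupleOf (tuple r)     = r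
  tupleOf (inner _ r _) = r

  heightOf : Vertex → ℕ
  heightOf (element _)   = 0
  heightOf (tuple _)     = 2 + K
  heightOf (inner a r i) = height (sides a r) (suc (inject₁ i))

  kindOf : Vertex → Kind
  kindOf (element _)   = joint
  kindOf (tuple _)     = joint
  kindOf (inner a r i) = kind (sides a r) (suc (inject₁ i))

  place-inner : ∀ a r i → place a r (suc (inject₁ i)) ≡ inner a r i
  place-inner a r i rewrite view-inject₁ i = refl

  place-fromℕ : ∀ a r → place a r (fromℕ _) ≡ tuple r
  place-fromℕ a r rewrite view-fromℕ (List.length (core (agreement a r) ++ edge)) = refl

  node-top : ∀ a r κ → node a r (2 + K) κ ≡ tuple r
  node-top a r κ = trans (cong (place a r) (vertexAt-top (sides a r) κ)) (place-fromℕ a r)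

  -- The fillers are harmless: the bottom of a path is determined by its element alone and the top
  -- by its tuple alone.
  node-coordinates : ∀ u → node (elementOf u) (tupleOf u) (heightOf u) (kindOf u) ≡ u
  node-coordinates (element a) = refl
  node-coordinates (tuple r)   = node-top point r joint
  node-coordinates (inner a r i) =
    trans (cong (place a r) (vertexAt-height-kind (sides a r) (suc (inject₁ i)))) (place-inner a r i)

  heightOf-place : ∀ a r x → heightOf (place a r x) ≡ height (sides a r) x
  heightOf-place a r zero = refl
  heightOf-place a r (suc j) with view j
  ... | ‵fromℕ     = sym (height-fromℕ (sides a r))
  ... | ‵inject₁ i = refl

  kindOf-place : ∀ a r x → kindOf (place a r x) ≡ kind (sides a r) x
  kindOf-place a r zero = refl
  kindOf-place a r (suc j) with view j
  ... | ‵fromℕ     = sym (kind-fromℕ (sides a r))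
  ... | ‵inject₁ i = refl

  elementOf-place : ∀ a r x → height (sides a r) x ≤ suc K → elementOf (place a r x) ≡ a
  elementOf-place a r zero    _ = refl
  elementOf-place a r (suc j) h≤ with view j
  ... | ‵fromℕ     = contradiction (subst (_≤ suc K) (height-fromℕ (sides a r)) h≤) ℕ.1+n≰n
  ... | ‵inject₁ i = refl

  tupleOf-place : ∀ a r x → height (sides a r) x ≢ 0 → tupleOf (place a r x) ≡ r
  tupleOf-place a r zero    h≢0 = contradiction refl h≢0
  tupleOf-place a r (suc j) _ with view j
  ... | ‵fromℕ     = refl
  ... | ‵inject₁ i = refl

  heightOf≤ : ∀ u → heightOf u ≤ 2 + K
  heightOf≤ (element _)   = z≤n
  heightOf≤ (tuple _)     = ℕ.≤-refl
  heightOf≤ (inner a r i) = height≤ (sides a r) (suc (inject₁ i))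

  -- The source of an edge is never in R and its target never in A, so `elementOf u` and `tupleOf v`
  -- are no fillers and name the path that carries the edge. The other two coordinates agree with
  -- these unless v is in R or u is in A.
  record Step (u v : Vertex) : Set where
    field
      rises       : heightOf v ≡ suc (heightOf u)
      below       : heightOf u ≤ suc K
      arc         : Arc (side (sides (elementOf u) (tupleOf v)) (heightOf u)) (kindOf u) (kindOf v)
      sameElement : heightOf v ≤ suc K → elementOf u ≡ elementOf v
      sameTuple   : heightOf u ≢ 0 → tupleOf u ≡ tupleOf v
  open Step public

  ⟶⇒Step : ∀ {u v} → u ⟶ v → Step u v
  ⟶⇒Step {u} {v} (a , r , x , y , e , refl , refl)
    with climbs rises′ below′ arc′ ← edge⇒climbs (sides a r) e = record
    { rises       = trans hy (trans rises′ (cong suc (sym hx)))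
    ; below       = subst (_≤ suc K) (sym hx) below′
    ; arc         = subst₂ (λ b s → Arc (side (sides b s) (heightOf u)) (kindOf u) (kindOf v)) (sym ax) (sym ry)
                      (subst (λ h → Arc (side (sides a r) h) (kindOf u) (kindOf v)) (sym hx)
                        (subst₂ (Arc _) (sym (kindOf-place a r x)) (sym (kindOf-place a r y)) arc′))
    ; sameElement = λ h≤ → trans ax (sym (elementOf-place a r y (subst (_≤ suc K) hy h≤)))
    ; sameTuple   = λ h≢0 → trans (tupleOf-place a r x (h≢0 ∘ trans hx)) (sym ry)
    }
    where
    hx = heightOf-place a r x
    hy = heightOf-place a r y
    ax = elementOf-place a r x below′
    ry = tupleOf-place a r y (λ eq → ℕ.1+n≢0 (trans (sym rises′) eq))

  node-⟶ : ∀ a r h {κ κ′} → h ≤ suc K → Lower κ → Upper κ′ →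
           (side (sides a r) h ≡ outside → Arc outside κ κ′) →
           node a r h κ ⟶ node a r (suc h) κ′
  node-⟶ a r h h≤ l u arc = a , r , _ , _ , arc⇒edge (sides a r) h h≤ l u arc , refl , refl

-- Polymorphisms of digraphs and evaluation of linear terms

module _ {V : Set} {E : Rel V 0ℓ} where

  uncurry₂⁺ : ∀ w → E (lookup w zero) (lookup w (suc zero)) → uncurry₂ E w
  uncurry₂⁺ (_ ∷ _ ∷ []) e = e

  uncurry₂⁻ : ∀ w → uncurry₂ E w → E (lookup w zero) (lookup w (suc zero))
  uncurry₂⁻ (_ ∷ _ ∷ []) e = e

  Preserves : ∀ {m} → Operation m V → Set
  Preserves f = ∀ us vs → (∀ i → E (lookup us i) (lookup vs i)) → E (f us) (f vs)

  polymorphism⇒preserves : ∀ {m} {f : Operation m V} → IsPolymorphism (digraph V E) f → Preserves f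
  polymorphism⇒preserves {f = f} poly us vs es = subst₂ E
    (trans (lookup-✴ f rs zero) (cong f (lookup-ext λ i →
      trans (Vec.lookup-map i _ rs) (cong (λ r → lookup r zero) (Vec.lookup-zipWith _ i us vs)))))
    (trans (lookup-✴ f rs (suc zero)) (cong f (lookup-ext λ i →
      trans (Vec.lookup-map i _ rs) (cong (λ r → lookup r (suc zero)) (Vec.lookup-zipWith _ i us vs)))))
    (uncurry₂⁻ (f ✴ rs) (poly zero rs (All.lookup⁻ λ i →
      subst (uncurry₂ E) (sym (Vec.lookup-zipWith pair i us vs)) (es i))))
    where
    pair : V → V → Vec V 2
    pair u v = u ∷ v ∷ []
    rs : Vec (Vec V 2) _
    rs = Vec.zipWith pair us vs

  preserves⇒polymorphism : ∀ {m} {f : Operation m V} → Preserves f → IsPolymorphism (digraph V E) f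
  preserves⇒polymorphism {f = f} pres zero rs es = uncurry₂⁺ (f ✴ rs)
    (subst₂ E (sym (lookup-✴ f rs zero)) (sym (lookup-✴ f rs (suc zero)))
      (pres _ _ λ i → subst₂ E (sym (Vec.lookup-map i _ rs)) (sym (Vec.lookup-map i _ rs))
        (uncurry₂⁻ (lookup rs i) (All.lookup⁺ es i))))

module _ {s} {𝑆 : Signature s} where
  open Signature 𝑆

  data Shallow : Term 𝑆 → Set s where
    var : ∀ x → Shallow (var x)
    op  : ∀ f xs → Shallow (op f (map var xs))

  variables : ∀ {n} (ts : Vec (Term 𝑆) n) → List.length (symbolsᵛ ts) ≤ 0 → ∃[ xs ] ts ≡ map var xs
  variables []              _  = [] , refl
  variables (var x ∷ ts)    ≤0 = let xs , eq = variables ts ≤0 in x ∷ xs , cong (var x ∷_) eq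
  variables (op f ts ∷ us)  ()

  shallow : ∀ u → List.length (symbols u) ≤ 1 → Shallow u
  shallow (var x)   _        = var x
  shallow (op f ts) (s≤s ≤0) with xs , refl ← variables ts ≤0 = op f xs

  evalᵛ-variables : ∀ {A : Set} (⟦_⟧ : (f : Symbol) → Operation (symbolArity f) A) ρ
                    {n} (xs : Vec ℕ n) → evalᵛ {𝑆 = 𝑆} ⟦_⟧ ρ (map var xs) ≡ map ρ xs
  evalᵛ-variables ⟦_⟧ ρ []       = refl
  evalᵛ-variables ⟦_⟧ ρ (x ∷ xs) = cong (ρ x ∷_) (evalᵛ-variables ⟦_⟧ ρ xs)

-- From 𝓓(𝔸) to 𝔸

module Restriction (𝔸 : Structure) (fin : IsFinite 𝔸) where
  open Coordinates 𝔸 fin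

  -- The source is both lower and upper, hence a joint, and so is the target; only a single edge
  -- joins two joints. This is how a = r_l is detected.
  squeeze : ∀ {s κ κ′} → Arc s κ κ′ → Upper κ → Lower κ′ → s ≡ inside
  squeeze straight _ _ = refl

  module _ {m} (f : Operation m Vertex) (pres : Preserves {E = _⟶_} f) where

    onElements : Operation m Carrier
    onElements as = elementOf (f (map element as))

    onTuples : Operation m Tuple
    onTuples rs = tupleOf (f (map tuple rs))

    module _ (as : Vec Carrier m) (rs : Vec Tuple m) where

      row : ℕ → Kind → Vec Vertex m
      row h κ = Vec.zipWith (λ a r → node a r h κ) as rs

      -- The image under f of a family of copies of ℚ ∅.
      image : ℕ → Kind → Vertex
      image h κ = f (row h κ)

      image-⟶ : ∀ {h κ κ′} → h ≤ suc K → Lower κ → Upper κ′ →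
                (∀ i → side (sides (lookup as i) (lookup rs i)) h ≡ outside → Arc outside κ κ′) →
                image h κ ⟶ image (suc h) κ′
      image-⟶ h≤ l u arc = pres _ _ λ i → subst₂ _⟶_
        (sym (Vec.lookup-zipWith _ i as rs)) (sym (Vec.lookup-zipWith _ i as rs))
        (node-⟶ (lookup as i) (lookup rs i) _ h≤ l u (arc i))

      rise-step : ∀ {h} → h ≤ suc K → Step (image h joint) (image (suc h) peak)
      rise-step h≤ = ⟶⇒Step (image-⟶ h≤ joint peak λ _ _ → rise)

      fall-step : ∀ {h} → h ≤ suc K → Step (image h valley) (image (suc h) peak)
      fall-step h≤ = ⟶⇒Step (image-⟶ h≤ valley peak λ _ _ → fall)

      climb-step : ∀ {h} → h ≤ suc K → Step (image h valley) (image (suc h) joint)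
      climb-step h≤ = ⟶⇒Step (image-⟶ h≤ valley joint λ _ _ → climb)

      -- Both have an edge to the image of the peak one level up.
      heightOf-valley : ∀ {h} → h ≤ suc K → heightOf (image h valley) ≡ heightOf (image h joint)
      heightOf-valley h≤ = ℕ.suc-injective (trans (sym (rises (fall-step h≤))) (rises (rise-step h≤)))

      heightOf-suc : ∀ {h} → h ≤ suc K → heightOf (image (suc h) joint) ≡ suc (heightOf (image h joint))
      heightOf-suc h≤ = trans (rises (climb-step h≤)) (cong suc (heightOf-valley h≤))

      heightOf-+ : ∀ h → h ≤ 2 + K → heightOf (image h joint) ≡ h + heightOf (image 0 joint)
      heightOf-+ zero    _        = refl
      heightOf-+ (suc h) (s≤s h≤) = trans (heightOf-suc h≤) (cong suc (heightOf-+ h (ℕ.m≤n⇒m≤1+n h≤)))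

      -- The image climbs through 2 + K levels, so it must start at the bottom.
      heightOf-zero : heightOf (image 0 joint) ≡ 0
      heightOf-zero = ℕ.n≤0⇒n≡0 (ℕ.+-cancelˡ-≤ (2 + K) _ 0 (subst₂ _≤_
        (heightOf-+ (2 + K) ℕ.≤-refl) (sym (ℕ.+-identityʳ (2 + K))) (heightOf≤ (image (2 + K) joint))))

      heightOf-image : ∀ h → h ≤ 2 + K → heightOf (image h joint) ≡ h
      heightOf-image h h≤ = trans (heightOf-+ h h≤) (trans (cong (h +_) heightOf-zero) (ℕ.+-identityʳ h))

      -- Walks down the image of a zigzag, joint ← valley → peak ← joint. None of its edges reaches
      -- R, so the element never changes.
      elementOf-image : ∀ h → h ≤ suc K → elementOf (image h joint) ≡ elementOf (image 0 joint)
      elementOf-image zero    _  = refl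
      elementOf-image (suc h) h≤ = trans (sym (sameElement (climb-step h≤′) (≤K (rises (climb-step h≤′)) (heightOf-valley h≤′))))
        (trans (sameElement (fall-step h≤′) (≤K (rises (fall-step h≤′)) (heightOf-valley h≤′)))
        (trans (sym (sameElement (rise-step h≤′) (≤K (rises (rise-step h≤′)) refl)))
               (elementOf-image h h≤′)))
        where
        h≤′ = ℕ.<⇒≤ h≤
        ≤K : ∀ {x y} → x ≡ suc y → y ≡ heightOf (image h joint) → x ≤ suc K
        ≤K refl refl = subst (λ x → suc x ≤ suc K) (sym (heightOf-image h (ℕ.m≤n⇒m≤1+n h≤′))) h≤

      -- The dual walk: no lower end on the zigzag is in A, so the tuple never changes.
      tupleOf-suc : ∀ h → suc h ≤ suc K → tupleOf (image (suc h) joint) ≡ tupleOf (image (2 + h) joint)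
      tupleOf-suc h h≤ = trans (sameTuple (rise-step h≤) ≢0) (trans
        (sym (sameTuple (fall-step h≤) (≢0 ∘ trans (sym (heightOf-valley h≤)))))
        (sameTuple (climb-step h≤) (≢0 ∘ trans (sym (heightOf-valley h≤)))))
        where
        ≢0 : heightOf (image (suc h) joint) ≢ 0
        ≢0 eq = ℕ.1+n≢0 (trans (sym (heightOf-image (suc h) (ℕ.m≤n⇒m≤1+n h≤))) eq)

      tupleOf-image : ∀ d h → d + suc h ≡ 2 + K → tupleOf (image (suc h) joint) ≡ tupleOf (image (2 + K) joint)
      tupleOf-image zero    h refl = refl
      tupleOf-image (suc d) h eq   = trans
        (tupleOf-suc h (ℕ.≤-trans (ℕ.m≤n+m (suc h) d) (ℕ.≤-reflexive (ℕ.suc-injective eq))))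
        (tupleOf-image d (suc h) (trans (ℕ.+-suc d (suc h)) eq))

      element-row : row 0 joint ≡ map element as
      element-row = lookup-ext λ i → trans (Vec.lookup-zipWith _ i as rs) (sym (Vec.lookup-map i element as))

      tuple-row : row (2 + K) joint ≡ map tuple rs
      tuple-row = lookup-ext λ i → trans (Vec.lookup-zipWith _ i as rs)
        (trans (node-top _ _ joint) (sym (Vec.lookup-map i tuple rs)))

      entry-preserved : ∀ l → (∀ i → lookup as i ≡ entry l (lookup rs i)) →
                        onElements as ≡ entry l (onTuples rs)
      entry-preserved l eq = trans (sym elements)
        (trans (agreement-inside a′ r′ l agree) (cong (entry l) tuples))
        where
        -- As `sides` begins with the initial edge, entry l controls the segment between the levels
        -- h + 1 and h + 2.
        h = Fin.toℕ l
        h<K : h < K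
        h<K = Fin.toℕ<n l
        h≤ : h ≤ suc K
        h≤ = ℕ.m≤n⇒m≤1+n (ℕ.<⇒≤ h<K)
        edge-inside : ∀ i → side (sides (lookup as i) (lookup rs i)) (suc h) ≡ inside
        edge-inside i = trans (side-lookup (agreement (lookup as i) (lookup rs i)) l)
          (trans (Vec.lookup-map l _ (value (lookup rs i))) (dec-true (lookup as i ≟ _) (eq i)))
        straight-step : Step (image (suc h) joint) (image (2 + h) joint)
        straight-step = ⟶⇒Step (image-⟶ (ℕ.m≤n⇒m≤1+n h<K) joint joint λ i out →
          contradiction (trans (sym (edge-inside i)) out) λ ())
        a′ = elementOf (image (suc h) joint)
        r′ = tupleOf (image (2 + h) joint)
        agree : lookup (agreement a′ r′) l ≡ inside
        agree = trans (sym (side-lookup (agreement a′ r′) l))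
          -- The source of the straight edge also ends a climb from level h, and its target also
          -- begins a rise to level h + 3. The first and last edges of the paths provide these outer
          -- levels.
          (subst (λ x → side (sides a′ r′) x ≡ inside) (heightOf-image (suc h) (s≤s h≤))
            (squeeze (arc straight-step) (upper (arc (climb-step h≤))) (lower (arc (rise-step (s≤s h<K))))))
        elements : a′ ≡ onElements as
        elements = trans (elementOf-image (suc h) (ℕ.m≤n⇒m≤1+n h<K)) (cong (elementOf ∘ f) element-row)
        tuples : r′ ≡ onTuples rs
        tuples = trans (tupleOf-image (K ∸ h) (suc h)
          (trans (ℕ.+-suc (K ∸ h) (suc h)) (cong suc (trans (ℕ.+-suc (K ∸ h) h) (cong suc (ℕ.m∸n+n≡m (ℕ.<⇒≤ h<K)))))))
          (cong (tupleOf ∘ f) tuple-row)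

    onElements-entry : ∀ l rs → onElements (map (entry l) rs) ≡ entry l (onTuples rs)
    onElements-entry l rs = entry-preserved (map (entry l) rs) rs l λ i → Vec.lookup-map i (entry l) rs

    onElements-polymorphism : IsPolymorphism 𝔸 onElements
    onElements-polymorphism i vs vs∈ = subst (relation i) (sym eq)
      (product⁻ arity (tuple-∈ (onTuples rs)) i)
      where
      -- Only tuples of the full product R are at hand, so a tuple of the i-th relation is completed
      -- by chosen tuples of the other relations.
      blocks : ∀ {v} → relation i v → ∀ j → ∃ (relation j)
      blocks p j with j Fin.≟ i
      ... | yes refl = _ , p
      ... | no  _    = nonempty j
      extend : ∀ {v} → relation i v → Tuple
      extend p = join arity (λ j → proj₁ (blocks p j)) , [ product⁺ arity (λ j →
        subst (relation j) (sym (block-join arity _ j)) (proj₂ (blocks p j))) ]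
      blocks-self : ∀ {v} (p : relation i v) → proj₁ (blocks p i) ≡ v
      blocks-self p with i Fin.≟ i
      ... | yes refl = refl
      ... | no  i≢i  = contradiction refl i≢i
      block-extend : ∀ {v} (p : relation i v) → block arity i (value (extend p)) ≡ v
      block-extend p = trans (block-join arity _ i) (blocks-self p)
      rs : Vec Tuple m
      rs = All.reduce extend vs∈
      columns : ∀ {n} {vs : Vec _ n} (ps : All (relation i) vs) j →
                map (λ v → lookup v j) vs ≡ map (entry (offset {Carrier} arity i j)) (All.reduce extend ps)
      columns []       j = refl
      columns (p ∷ ps) j = cong₂ _∷_
        (trans (cong (λ v → lookup v j) (sym (block-extend p))) (lookup-block arity i _ j)) (columns ps j)
      eq : onElements ✴ vs ≡ block arity i (value (onTuples rs))
      eq = lookup-ext λ j → trans (lookup-✴ onElements vs j) (trans (cong onElements (columns vs∈ j))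
        (trans (onElements-entry _ rs) (sym (lookup-block arity i _ j))))

  -- A linear term applies at most one operation, so evaluating it on A amounts to evaluating on
  -- 𝓓(𝔸) and applying `elementOf` once at the end.
  restrict : ∀ {s ℓ} {𝑆 : Signature s} {Σ : Pred (Identity 𝑆) ℓ} →
             Linear Σ → 𝓓 𝔸 fin ⊨ Σ → 𝔸 ⊨ Σ
  restrict {𝑆 = 𝑆} linear (⟦_⟧ , poly , holds) =
    ⟦_⟧′ , (λ f → onElements-polymorphism ⟦ f ⟧ (polymorphism⇒preserves (poly f))) , λ u v ∈Σ ρ →
      let u-lin , v-lin = linear (u ≈ v) ∈Σ in
      trans (eval-restrict ρ (shallow u u-lin))
        (trans (cong elementOf (holds u v ∈Σ (element ∘ ρ))) (sym (eval-restrict ρ (shallow v v-lin))))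
    where
    open Signature 𝑆
    ⟦_⟧′ : (f : Symbol) → Operation (symbolArity f) Carrier
    ⟦ f ⟧′ = onElements ⟦ f ⟧ (polymorphism⇒preserves (poly f))
    eval-restrict : ∀ ρ {u} → Shallow u → eval ⟦_⟧′ ρ u ≡ elementOf (eval ⟦_⟧ (element ∘ ρ) u)
    eval-restrict ρ (var x)   = refl
    eval-restrict ρ (op f xs) = cong (elementOf ∘ ⟦ f ⟧) (trans
      (cong (map element) (evalᵛ-variables ⟦_⟧′ ρ xs))
      (trans (sym (Vec.map-∘ element ρ xs)) (sym (evalᵛ-variables ⟦_⟧ (element ∘ ρ) xs))))

-- Choosing from lists in a way that depends on their sets of elements only

module _ {X : Set} where

  first : ∀ {P : Pred X 0ℓ} → Decidable P → X → List X → X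
  first P? d []       = d
  first P? d (x ∷ xs) = if does (P? x) then x else first P? d xs

  first-satisfies : ∀ {P : Pred X 0ℓ} (P? : Decidable P) d {x xs} → x ∈ˡ xs → P x → P (first P? d xs)
  first-satisfies P? d {xs = y ∷ _} x∈ Px with P? y
  first-satisfies P? d x∈           Px | yes Py = Py
  first-satisfies P? d (here refl)  Px | no ¬Py = contradiction Px ¬Py
  first-satisfies P? d (there x∈)   Px | no ¬Py = first-satisfies P? d x∈ Px

  first-cong : ∀ {P Q : Pred X 0ℓ} (P? : Decidable P) (Q? : Decidable Q) d →
               (∀ {x} → P x → Q x) → (∀ {x} → Q x → P x) → ∀ xs → first P? d xs ≡ first Q? d xs
  first-cong P? Q? d p q []       = refl
  first-cong P? Q? d p q (x ∷ xs) with P? x | Q? x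
  ... | yes _  | yes _  = refl
  ... | yes Px | no ¬Qx = contradiction (p Px) ¬Qx
  ... | no ¬Px | yes Qx = contradiction (q Qx) ¬Px
  ... | no _   | no _   = first-cong P? Q? d p q xs

record Finite (X : Set) : Set where
  field
    default  : X
    all      : List X
    ∈-all    : ∀ x → x ∈ˡ all
    _≟ᶠ_     : DecidableEquality X

module _ {V X : Set} (F : Finite X) (key : V → X) where
  open Finite F

  Hit : List V → Pred X 0ℓ
  Hit S x = Any (λ s → key s ≡ x) S

  hit? : ∀ S → Decidable (Hit S)
  hit? S x = any? (λ s → key s ≟ᶠ x) S

  opaque
    choose : List V → X
    choose S = first (hit? S) default all

    choose-∈ : ∀ {S s} → s ∈ˡ S → ∃[ t ] t ∈ˡ S × key t ≡ choose S
    choose-∈ {S} s∈ =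
      find (first-satisfies (hit? S) default (∈-all _) (lose s∈ refl))

  choose-constant : ∀ {S x s} → s ∈ˡ S → (∀ {t} → t ∈ˡ S → key t ≡ x) → choose S ≡ x
  choose-constant s∈ const = let t , t∈ , eq = choose-∈ s∈ in trans (sym eq) (const t∈)

  slice : List V → List V
  slice S = filter (λ s → key s ≟ᶠ choose S) S

  slice⁺ : ∀ {S s} → s ∈ˡ S → key s ≡ choose S → s ∈ˡ slice S
  slice⁺ = ∈-filter⁺ _

  slice⁻ : ∀ {S s} → s ∈ˡ slice S → s ∈ˡ S × key s ≡ choose S
  slice⁻ {S} = ∈-filter⁻ (λ s → key s ≟ᶠ choose S) {xs = S}

  slice-nonempty : ∀ {S s} → s ∈ˡ S → ∃[ t ] t ∈ˡ slice S
  slice-nonempty s∈ = let t , t∈ , eq = choose-∈ s∈ in t , slice⁺ t∈ eq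

module _ {V : Set} (h : V → ℕ) where

  lowest highest : List V → ℕ
  lowest []       = 0
  lowest (s ∷ S)  = h (argmin h s S)
  highest []      = 0
  highest (s ∷ S) = h (argmax h s S)

  lowest-∈ : ∀ {S s} → s ∈ˡ S → ∃[ t ] t ∈ˡ S × h t ≡ lowest S
  lowest-∈ {s ∷ S} _ with argmin-sel h s S
  ... | inj₁ eq = s , here refl , cong h (sym eq)
  ... | inj₂ t∈ = _ , there t∈ , refl

  highest-∈ : ∀ {S s} → s ∈ˡ S → ∃[ t ] t ∈ˡ S × h t ≡ highest S
  highest-∈ {s ∷ S} _ with argmax-sel h s S
  ... | inj₁ eq = s , here refl , cong h (sym eq)
  ... | inj₂ t∈ = _ , there t∈ , refl

  lowest-≤ : ∀ {S s} → s ∈ˡ S → lowest S ≤ h s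
  lowest-≤ {s ∷ S} (here refl) = f[argmin]≤f[⊤] {f = h} s S
  lowest-≤ {s ∷ S} (there t∈)  = Allˡ.lookup (f[argmin]≤f[xs] {f = h} s S) t∈

  highest-≥ : ∀ {S s} → s ∈ˡ S → h s ≤ highest S
  highest-≥ {s ∷ S} (here refl) = f[⊥]≤f[argmax] {f = h} s S
  highest-≥ {s ∷ S} (there t∈)  = Allˡ.lookup (f[xs]≤f[argmax] {f = h} s S) t∈

  lowest-constant : ∀ {S s x} → s ∈ˡ S → (∀ {t} → t ∈ˡ S → h t ≡ x) → lowest S ≡ x
  lowest-constant s∈ const = let _ , t∈ , eq = lowest-∈ s∈ in trans (sym eq) (const t∈)

  level : ∀ {S s} → lowest S ≡ highest S → s ∈ˡ S → h s ≡ lowest S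
  level eq s∈ = ℕ.≤-antisym (ℕ.≤-trans (highest-≥ s∈) (ℕ.≤-reflexive (sym eq))) (lowest-≤ s∈)

-- S and T arise from an edge between two tuples with sets of entries S and T.
record Cover {V : Set} (E : Rel V 0ℓ) (S T : List V) : Set where
  field
    forth : ∀ {s} → s ∈ˡ S → ∃[ t ] t ∈ˡ T × E s t
    back  : ∀ {t} → t ∈ˡ T → ∃[ s ] s ∈ˡ S × E s t
open Cover

module _ {V : Set} {E : Rel V 0ℓ} {S T : List V} (C : Cover E S T) where

  filter-cover : ∀ {P Q : Pred V 0ℓ} (P? : Decidable P) (Q? : Decidable Q) →
                 (∀ {s t} → s ∈ˡ S → t ∈ˡ T → E s t → P s → Q t) →
                 (∀ {s t} → s ∈ˡ S → t ∈ˡ T → E s t → Q t → P s) →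
                 Cover E (filter P? S) (filter Q? T)
  filter-cover P? Q? p q = record
    { forth = λ s∈ → let s∈S , Ps = ∈-filter⁻ P? {xs = S} s∈ ; t , t∈ , e = C .forth s∈S in
                     t , ∈-filter⁺ Q? t∈ (p s∈S t∈ e Ps) , e
    ; back  = λ t∈ → let t∈T , Qt = ∈-filter⁻ Q? {xs = T} t∈ ; s , s∈ , e = C .back t∈T in
                     s , ∈-filter⁺ P? s∈ (q s∈ t∈T e Qt) , e
    }

  module _ {X : Set} (F : Finite X) (key : V → X)
           (same : ∀ {s t} → s ∈ˡ S → t ∈ˡ T → E s t → key s ≡ key t) where

    opaque
      unfolding choose

      -- A key that is constant along edges takes the same values on S and on T, so both searches
      -- stop at the same place.
      choose-cover : choose F key S ≡ choose F key T
      choose-cover = first-cong (hit? F key S) (hit? F key T) _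
        (λ hit → let s , s∈ , eq = find hit ; t , t∈ , e = C .forth s∈ in
                 lose t∈ (trans (sym (same s∈ t∈ e)) eq))
        (λ hit → let t , t∈ , eq = find hit ; s , s∈ , e = C .back t∈ in
                 lose s∈ (trans (same s∈ t∈ e) eq))
        (Finite.all F)

    slice-cover : Cover E (slice F key S) (slice F key T)
    slice-cover = filter-cover _ _
      (λ s∈ t∈ e eq → trans (sym (same s∈ t∈ e)) (trans eq choose-cover))
      (λ s∈ t∈ e eq → trans (same s∈ t∈ e) (trans eq (sym choose-cover)))

  module _ (h : V → ℕ) (rises : ∀ {s t} → E s t → h t ≡ suc (h s)) {s₀} (s₀∈ : s₀ ∈ˡ S) where

    -- A lowest entry of S has a successor in T and a lowest entry of T has a predecessor in S; this
    -- gives the two inequalities.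
    lowest-cover : lowest h T ≡ suc (lowest h S)
    lowest-cover with s , s∈ , eq ← lowest-∈ h s₀∈ with t , t∈ , e ← C .forth s∈
      with t′ , t′∈ , eq′ ← lowest-∈ h t∈ with s′ , s′∈ , e′ ← C .back t′∈ = ℕ.≤-antisym
      (ℕ.≤-trans (lowest-≤ h t∈) (ℕ.≤-reflexive (trans (rises e) (cong suc eq))))
      (ℕ.≤-trans (s≤s (lowest-≤ h s′∈)) (ℕ.≤-reflexive (trans (sym (rises e′)) eq′)))

    highest-cover : highest h T ≡ suc (highest h S)
    highest-cover with s , s∈ , eq ← highest-∈ h s₀∈ with t , t∈ , e ← C .forth s∈
      with t′ , t′∈ , eq′ ← highest-∈ h t∈ with s′ , s′∈ , e′ ← C .back t′∈ = ℕ.≤-antisym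
      (ℕ.≤-trans (ℕ.≤-reflexive (trans (sym eq′) (rises e′))) (s≤s (highest-≥ h s′∈)))
      (ℕ.≤-trans (ℕ.≤-reflexive (trans (cong suc (sym eq)) (sym (rises e)))) (highest-≥ h t∈))

-- Enumerations of kinds, tuples and vertices, and canonical choices

_≟ᵏ_ : DecidableEquality Kind
joint  ≟ᵏ joint  = yes refl
joint  ≟ᵏ peak   = no λ ()
joint  ≟ᵏ valley = no λ ()
peak   ≟ᵏ joint  = no λ ()
peak   ≟ᵏ peak   = yes refl
peak   ≟ᵏ valley = no λ ()
valley ≟ᵏ joint  = no λ ()
valley ≟ᵏ peak   = no λ ()
valley ≟ᵏ valley = yes refl

-- Listed in the order in which the vertices of one height occur along a path,
-- so that choose kinds picks the kind of the first of them.
kinds : Finite Kind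
kinds = record
  { default = joint
  ; all     = peak ∷ joint ∷ valley ∷ []
  ; ∈-all   = λ { peak → here refl ; joint → there (here refl) ; valley → there (there (here refl)) }
  ; _≟ᶠ_    = _≟ᵏ_
  }

opaque
  unfolding choose

  choose-peak : ∀ {V : Set} (key : V → Kind) {S} → Hit kinds key S peak → choose kinds key S ≡ peak
  choose-peak key {S} hit rewrite dec-true (hit? kinds key S peak) hit = refl

vectors : ∀ {A : Set} → List A → ∀ n → List (Vec A n)
vectors xs zero    = [] ∷ []
vectors xs (suc n) = List.cartesianProductWith _∷_ xs (vectors xs n)

∈-vectors : ∀ {A : Set} {xs : List A} → (∀ x → x ∈ˡ xs) → ∀ {n} (v : Vec A n) → v ∈ˡ vectors xs n
∈-vectors all []      = here refl
∈-vectors all (x ∷ v) = ∈-cartesianProductWith⁺ _∷_ (all x) (∈-vectors all v)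

module _ {A : Set} {P : Pred A 0ℓ} (P? : Decidable P) where

  refinements : List A → List [ x ∈ A ∣ P x ]
  refinements [] = []
  refinements (x ∷ xs) with P? x
  ... | yes p = (x , [ p ]) ∷ refinements xs
  ... | no  _ = refinements xs

  ∈-refinements : ∀ {xs} (r : [ x ∈ A ∣ P x ]) → value r ∈ˡ xs → r ∈ˡ refinements xs
  ∈-refinements {x ∷ xs} (v , [ p ]) v∈ with P? x
  ∈-refinements (v , [ p ]) (here refl) | yes _ = here refl
  ∈-refinements (v , [ p ]) (there v∈)  | yes _ = there (∈-refinements (v , [ p ]) v∈)
  ∈-refinements (v , [ p ]) (here refl) | no ¬p = contradiction (recompute (P? v) p) ¬p
  ∈-refinements (v , [ p ]) (there v∈)  | no _  = ∈-refinements (v , [ p ]) v∈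

module Choices (𝔸 : Structure) (fin : IsFinite 𝔸) where
  open Coordinates 𝔸 fin

  elements : Finite Carrier
  elements = record
    { default = point
    ; all     = List.map from (List.allFin _)
    ; ∈-all   = λ x → subst (_∈ˡ _) (strictlyInverseʳ x) (∈-map⁺ from (∈-allFin (to x)))
    ; _≟ᶠ_    = _≟_
    }
    where open Inverse (proj₂ finite)

  tuples : Finite Tuple
  tuples = record
    { default = witness
    ; all     = refinements (product? arity relation?) (vectors (Finite.all elements) K)
    ; ∈-all   = λ r → ∈-refinements (product? arity relation?) r (∈-vectors (Finite.∈-all elements) (value r))
    ; _≟ᶠ_    = Refinement._≟_ (Vec.≡-dec _≟_)
    }

  infix 4 _≟ᵛ_
  -- Comparing coordinates avoids the index of `inner`, whose type depends on the path.
  _≟ᵛ_ : DecidableEquality Vertex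
  u ≟ᵛ v = map′
    (λ { ((a , r) , (h , κ)) → trans (sym (node-coordinates u))
         (trans (cong₂ (λ a r → node a r (heightOf u) (kindOf u)) a r)
         (trans (cong₂ (node (elementOf v) (tupleOf v)) h κ) (node-coordinates v))) })
    (λ { refl → (refl , refl) , (refl , refl) })
    (((elementOf u ≟ elementOf v) ×-dec (Finite._≟ᶠ_ tuples (tupleOf u) (tupleOf v))) ×-dec
     ((heightOf u ℕ.≟ heightOf v) ×-dec (kindOf u ≟ᵏ kindOf v)))

  vertices : List Vertex
  vertices = List.map (λ { ((a , r) , (h , κ)) → node a r h κ })
    (List.cartesianProduct (List.cartesianProduct (Finite.all elements) (Finite.all tuples))
      (List.cartesianProduct (List.upTo (3 + K)) (Finite.all kinds)))

  ∈-vertices : ∀ u → u ∈ˡ vertices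
  ∈-vertices u = subst (_∈ˡ vertices) (node-coordinates u) (∈-map⁺ _
    (∈-cartesianProduct⁺
      (∈-cartesianProduct⁺ (Finite.∈-all elements (elementOf u)) (Finite.∈-all tuples (tupleOf u)))
      (∈-cartesianProduct⁺ (∈-upTo⁺ (s≤s (heightOf≤ u))) (Finite.∈-all kinds (kindOf u)))))

  occurs? : ∀ {m} (us : Vec Vertex m) → Decidable (λ u → ∃[ i ] lookup us i ≡ u)
  occurs? us u = Fin.any? λ i → lookup us i ≟ᵛ u

  opaque
    -- A list that depends on the set of entries of us only.
    entries : ∀ {m} → Vec Vertex m → List Vertex
    entries us = filter (occurs? us) vertices

    entries⁺ : ∀ {m} (us : Vec Vertex m) i → lookup us i ∈ˡ entries us
    entries⁺ us i = ∈-filter⁺ (occurs? us) (∈-vertices _) (i , refl)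

    entries⁻ : ∀ {m} (us : Vec Vertex m) {u} → u ∈ˡ entries us → ∃[ i ] lookup us i ≡ u
    entries⁻ us u∈ = proj₂ (∈-filter⁻ (occurs? us) {xs = vertices} u∈)

    entries-cong : ∀ {m n} (us : Vec Vertex m) (vs : Vec Vertex n) →
                   (∀ i → ∃[ j ] lookup vs j ≡ lookup us i) →
                   (∀ j → ∃[ i ] lookup us i ≡ lookup vs j) → entries us ≡ entries vs
    entries-cong us vs p q = filter-≐ (occurs? us) (occurs? vs)
      ( (λ { (i , refl) → p i }) , (λ { (j , refl) → q j }) ) vertices

  entries-cover : ∀ {m} (us vs : Vec Vertex m) → (∀ i → lookup us i ⟶ lookup vs i) →
                  Cover Step (entries us) (entries vs)
  entries-cover us vs es = record
    { forth = λ u∈ → let i , eq = entries⁻ us u∈ in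
              _ , entries⁺ vs i , subst (λ u → Step u (lookup vs i)) eq (⟶⇒Step (es i))
    ; back  = λ v∈ → let i , eq = entries⁻ vs v∈ in
              _ , entries⁺ us i , subst (Step (lookup us i)) eq (⟶⇒Step (es i))
    }

  -- The coordinates are chosen independently of each other; this is used on slices, where element
  -- and tuple are constant.
  pickAt : List Vertex → ℕ → Vertex
  pickAt S h = node (choose elements elementOf S) (choose tuples tupleOf S) h (choose kinds kindOf S)

  pick : List Vertex → Vertex
  pick S = pickAt S (lowest heightOf S)

  pick-constant : ∀ {S c s} → s ∈ˡ S → (∀ {t} → t ∈ˡ S → t ≡ c) → pick S ≡ c
  pick-constant {S} {c} s∈ const = trans
    (cong₂ (λ a r → node a r (lowest heightOf S) (choose kinds kindOf S))
      (choose-constant elements elementOf s∈ (cong elementOf ∘ const))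
      (choose-constant tuples tupleOf s∈ (cong tupleOf ∘ const)))
    (trans (cong₂ (node (elementOf c) (tupleOf c))
      (lowest-constant heightOf s∈ (cong heightOf ∘ const))
      (choose-constant kinds kindOf s∈ (cong kindOf ∘ const)))
    (node-coordinates c))

  -- Vertices of level 2 + K lack an element and those of level 0 lack a tuple,
  -- so pickLow serves below level 2 + K and pickHigh above level 0.
  sliceLow sliceHigh : List Vertex → List Vertex
  sliceLow  S = slice tuples tupleOf (slice elements elementOf S)
  sliceHigh S = slice elements elementOf (slice tuples tupleOf S)

  pickLow pickHigh : List Vertex → Vertex
  pickLow  S = pick (sliceLow S)
  pickHigh S = pick (sliceHigh S)

  -- Among a lower and an upper kind, only joint with joint fails to be an arc of a zigzag. But a
  -- joint chosen in S is followed by a peak in T, and peaks come first in `kinds`.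
  chosen-kinds : ∀ {x S T} → Cover Step S T →
                 (∀ {s t} → s ∈ˡ S → t ∈ˡ T → Step s t → Arc x (kindOf s) (kindOf t)) →
                 x ≡ outside → ∀ {s} → s ∈ˡ S → Arc outside (choose kinds kindOf S) (choose kinds kindOf T)
  chosen-kinds {S = S} {T} C arcs refl s∈
    with s₁ , s₁∈ , eq₁ ← choose-∈ kinds kindOf s∈ with t₁ , t₁∈ , st₁ ← C .Cover.forth s₁∈
    with t₂ , t₂∈ , eq₂ ← choose-∈ kinds kindOf t₁∈ with s₂ , s₂∈ , st₂ ← C .Cover.back t₂∈
    with choose kinds kindOf S | choose kinds kindOf T in eqT
       | subst (λ κ → Arc outside κ _) eq₁ (arcs s₁∈ t₁∈ st₁) | subst (Arc outside _) eq₂ (arcs s₂∈ t₂∈ st₂)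
  ... | joint  | peak   | _ | _ = rise
  ... | valley | peak   | _ | _ = fall
  ... | valley | joint  | _ | _ = climb
  ... | joint  | joint  | a | _ = contradiction (trans (sym eqT) peak-first) λ ()
    where
    squash : ∀ {κ} → Arc outside joint κ → κ ≡ peak
    squash rise = refl
    peak-first : choose kinds kindOf T ≡ peak
    peak-first = choose-peak kindOf (lose t₁∈ (squash a))

-- Edges between chosen vertices

side-length : ∀ {n} (I : Vec Side n) → side I n ≡ inside
side-length []      = refl
side-length (_ ∷ I) = side-length I

module Picking (𝔸 : Structure) (fin : IsFinite 𝔸) where
  open Coordinates 𝔸 fin
  open Choices 𝔸 fin

  -- The edge lies on the path from a to r′. A source in A forgets its tuple and a target in R its
  -- element, so r and a′ may be arbitrary there.
  nodes-⟶ : ∀ {a a′ r r′ h κ κ′} → h ≤ suc K → Lower κ → Upper κ′ →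
            (side (sides a r′) h ≡ outside → Arc outside κ κ′) →
            (h ≢ suc K → a ≡ a′) → (h ≢ 0 → r ≡ r′) →
            node a r h κ ⟶ node a′ r′ (suc h) κ′
  nodes-⟶ {a} {a′} {r} {r′} {h} {κ} {κ′} h≤ l u arc sameA sameR =
    subst₂ _⟶_ (source (h ℕ.≟ 0)) (target (h ℕ.≟ suc K)) (node-⟶ a r′ h h≤ l u arc)
    where
    source : Dec (h ≡ 0) → node a r′ h κ ≡ node a r h κ
    source (yes refl) = refl
    source (no h≢0)   = cong (λ r → node a r h κ) (sym (sameR h≢0))
    target : Dec (h ≡ suc K) → node a r′ (suc h) κ′ ≡ node a′ r′ (suc h) κ′
    target (yes refl) = trans (node-top a r′ κ′) (sym (node-top a′ r′ κ′))
    target (no h≢)    = cong (λ a → node a r′ (suc h) κ′) (sameA h≢)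

  gap : Vertex → Vertex → Side
  gap u v = side (sides (elementOf u) (tupleOf v)) (heightOf u)

  -- Codes have to be functions of a single vertex. Each end of an edge knows the segment between
  -- them: where one of its coordinates is a filler, the segment is an outer edge and a single edge
  -- anyway.
  sideAbove sideBelow : Vertex → Side
  sideAbove u = side (sides (elementOf u) (tupleOf u)) (heightOf u)
  sideBelow u = side (sides (elementOf u) (tupleOf u)) (heightOf u ∸ 1)

  gap-sideAbove : ∀ {u v} → Step u v → gap u v ≡ sideAbove u
  gap-sideAbove {u} {v} st with heightOf u | sameTuple st
  ... | zero  | _    = refl
  ... | suc h | same = cong (λ r → side (sides (elementOf u) r) (suc h)) (sym (same λ ()))

  gap-sideBelow : ∀ {u v} → Step u v → gap u v ≡ sideBelow v
  gap-sideBelow {u} {v} st rewrite rises st with heightOf u ℕ.≟ suc K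
  ... | yes eq rewrite eq =
    trans (side-length (agreement (elementOf u) (tupleOf v))) (sym (side-length (agreement (elementOf v) (tupleOf v))))
  ... | no  ne = cong (λ a → side (sides a (tupleOf v)) (heightOf u))
    (sameElement st (subst (_≤ suc K) (sym (rises st)) (ℕ.≤∧≢⇒< (below st) ne)))

  module _ {S T : List Vertex} {h : ℕ} (heights : ∀ {s} → s ∈ˡ S → heightOf s ≡ h)
           (C : Cover Step S T) where

    heights′ : ∀ {t} → t ∈ˡ T → heightOf t ≡ suc h
    heights′ t∈ = let _ , s∈ , st = C .Cover.back t∈ in trans (rises st) (cong suc (heights s∈))

    lowers : ∀ {s} → s ∈ˡ S → Lower (kindOf s)
    lowers s∈ = let _ , _ , st = C .Cover.forth s∈ in lower (arc st)

    uppers : ∀ {t} → t ∈ˡ T → Upper (kindOf t)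
    uppers t∈ = let _ , _ , st = C .Cover.back t∈ in upper (arc st)

    -- Here a and r name the path of the resulting edge. The chosen kinds matter over a zigzag only,
    -- so the cover is demanded only there.
    pick-⟶ : ∀ {S′ T′ s t} → s ∈ˡ S′ → t ∈ˡ T′ → (∀ {s} → s ∈ˡ S′ → s ∈ˡ S) → (∀ {t} → t ∈ˡ T′ → t ∈ˡ T) →
             ∀ {a r} → (∀ {s} → s ∈ˡ S′ → elementOf s ≡ a) → (∀ {t} → t ∈ˡ T′ → tupleOf t ≡ r) →
             (side (sides a r) h ≡ outside → Cover Step S′ T′) →
             (h ≢ suc K → ∀ {t} → t ∈ˡ T′ → elementOf t ≡ a) →
             (h ≢ 0 → ∀ {s} → s ∈ˡ S′ → tupleOf s ≡ r) →
             pick S′ ⟶ pick T′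
    pick-⟶ {S′} {T′} s∈ t∈ S′⊆S T′⊆T {a} {r} elements-S tuples-T C′ elements-T tuples-S =
      subst₂ (λ h₁ h₂ → pickAt S′ h₁ ⟶ pickAt T′ h₂)
        (sym (lowest-constant heightOf s∈ (heights ∘ S′⊆S))) (sym (lowest-constant heightOf t∈ (heights′ ∘ T′⊆T)))
        (nodes-⟶ (subst (_≤ suc K) (heights (S′⊆S s∈)) (below (proj₂ (proj₂ (C .Cover.forth (S′⊆S s∈))))))
          (let _ , s∈′ , eq = choose-∈ kinds kindOf s∈ in subst Lower eq (lowers (S′⊆S s∈′)))
          (let _ , t∈′ , eq = choose-∈ kinds kindOf t∈ in subst Upper eq (uppers (T′⊆T t∈′)))
          (λ out → let out′ = subst₂ (λ a r → side (sides a r) h ≡ outside) a≡ r≡ out in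
            chosen-kinds (C′ out′)
              (λ {s} {t} s∈ t∈ st → subst₂ (λ a r → Arc (side (sides a r) h) (kindOf s) (kindOf t)) (elements-S s∈) (tuples-T t∈)
                (subst (λ h → Arc (side (sides (elementOf s) (tupleOf t)) h) (kindOf s) (kindOf t)) (heights (S′⊆S s∈)) (arc st)))
              out′ s∈)
          (λ h≢ → trans a≡ (sym (choose-constant elements elementOf t∈ (elements-T h≢))))
          (λ h≢ → trans (choose-constant tuples tupleOf s∈ (tuples-S h≢)) (sym r≡)))
      where
      a≡ : choose elements elementOf S′ ≡ a
      a≡ = choose-constant elements elementOf s∈ elements-S
      r≡ : choose tuples tupleOf T′ ≡ r
      r≡ = choose-constant tuples tupleOf t∈ tuples-T

    pickLow-⟶ : ∀ {s} → s ∈ˡ S → suc h ≤ suc K → pickLow S ⟶ pickLow T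
    pickLow-⟶ s∈ h<K =
      let t , t∈ , _ = C .Cover.forth s∈
          _ , s∈′ = slice-nonempty elements elementOf s∈ ; _ , s∈″ = slice-nonempty tuples tupleOf s∈′
          _ , t∈′ = slice-nonempty elements elementOf t∈ ; _ , t∈″ = slice-nonempty tuples tupleOf t∈′
      in pick-⟶ s∈″ t∈″ (proj₁ ∘ back₁ ∘ proj₁ ∘ back₂) (proj₁ ∘ back₁ ∘ proj₁ ∘ back₂)
        (proj₂ ∘ back₁ ∘ proj₁ ∘ back₂) (proj₂ ∘ back₂)
        -- At level 0 the tuples of S are fillers and the slices by tuple may fail to correspond,
        -- but the segment above is the initial edge.
        (λ out → slice-cover C₁ tuples tupleOf (same₂ (λ { refl → contradiction out λ () })))
        (λ _ t∈ → trans (proj₂ (back₁ (proj₁ (back₂ t∈)))) (sym (choose-cover C elements elementOf same₁)))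
        (λ h≢ s∈ → trans (proj₂ (back₂ s∈)) (choose-cover C₁ tuples tupleOf (same₂ h≢)))
      where
      back₁ : ∀ {S s} → s ∈ˡ slice elements elementOf S → _
      back₁ {S} = slice⁻ elements elementOf {S}
      back₂ : ∀ {S s} → s ∈ˡ slice tuples tupleOf S → _
      back₂ {S} = slice⁻ tuples tupleOf {S}
      same₁ : ∀ {s t} → s ∈ˡ S → t ∈ˡ T → Step s t → elementOf s ≡ elementOf t
      same₁ _ t∈ st = sameElement st (subst (_≤ suc K) (sym (heights′ t∈)) h<K)
      C₁ = slice-cover C elements elementOf same₁
      same₂ : h ≢ 0 → ∀ {s t} → s ∈ˡ slice elements elementOf S → t ∈ˡ slice elements elementOf T →
              Step s t → tupleOf s ≡ tupleOf t
      same₂ h≢ s∈ _ st = sameTuple st (h≢ ∘ trans (sym (heights (proj₁ (back₁ {S} s∈)))))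

    pickHigh-⟶ : ∀ {s} → s ∈ˡ S → h ≢ 0 → pickHigh S ⟶ pickHigh T
    pickHigh-⟶ s∈ h≢0 =
      let t , t∈ , st = C .Cover.forth s∈
          h≤ = subst (_≤ suc K) (heights s∈) (below st)
          _ , s∈′ = slice-nonempty tuples tupleOf s∈ ; _ , s∈″ = slice-nonempty elements elementOf s∈′
          _ , t∈′ = slice-nonempty tuples tupleOf t∈ ; _ , t∈″ = slice-nonempty elements elementOf t∈′
      in pick-⟶ s∈″ t∈″ (proj₁ ∘ back₁ ∘ proj₁ ∘ back₂) (proj₁ ∘ back₁ ∘ proj₁ ∘ back₂)
        (proj₂ ∘ back₂) (proj₂ ∘ back₁ ∘ proj₁ ∘ back₂)
        -- Dually, at level K + 1 the elements of T are fillers, but the segment above is the last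
        -- edge.
        (λ out → slice-cover C₁ elements elementOf (same₂ h≤ (λ { refl →
          contradiction (trans (sym (side-length (agreement
            (choose elements elementOf (slice tuples tupleOf S)) (choose tuples tupleOf T)))) out) λ () })))
        (λ h≢ t∈ → trans (proj₂ (back₂ t∈)) (sym (choose-cover C₁ elements elementOf (same₂ h≤ h≢))))
        (λ _ s∈ → trans (proj₂ (back₁ (proj₁ (back₂ s∈)))) (choose-cover C tuples tupleOf same₁))
      where
      back₁ : ∀ {S s} → s ∈ˡ slice tuples tupleOf S → _
      back₁ {S} = slice⁻ tuples tupleOf {S}
      back₂ : ∀ {S s} → s ∈ˡ slice elements elementOf S → _
      back₂ {S} = slice⁻ elements elementOf {S}
      same₁ : ∀ {s t} → s ∈ˡ S → t ∈ˡ T → Step s t → tupleOf s ≡ tupleOf t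
      same₁ s∈ _ st = sameTuple st (h≢0 ∘ trans (sym (heights s∈)))
      C₁ = slice-cover C tuples tupleOf same₁
      same₂ : h ≤ suc K → h ≢ suc K → ∀ {s t} → s ∈ˡ slice tuples tupleOf S → t ∈ˡ slice tuples tupleOf T →
              Step s t → elementOf s ≡ elementOf t
      same₂ h≤ h≢ _ t∈ st = sameElement st
        (subst (_≤ suc K) (sym (heights′ (proj₁ (back₁ {T} t∈)))) (ℕ.≤∧≢⇒< h≤ h≢))

-- From 𝔸 to 𝓓(𝔸)

-- The zigzag is 0 → 1 ← 2 → 3.
_⟶ᶻ_ : Rel (Fin 4) 0ℓ
_⟶ᶻ_ = PathEdge zigzag

pattern z₀ = zero
pattern z₁ = suc zero
pattern z₂ = suc (suc zero)
pattern z₃ = suc (suc (suc zero))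

-- Codes for the kinds of the entries of a tuple all of whose entries are lower
-- (upper) ends of segments at one level.  A joint at a single edge has to be
-- placed on the zigzag so as to follow the entries on zigzags: it goes to the
-- outer end only if all entries are joints.  The flag says whether some entry
-- is a valley (a peak).
codeLow codeHigh : Bool → Side → Kind → Fin 4
codeLow _     _       valley = z₂
codeLow true  inside  _      = z₂
codeLow true  outside _      = z₀
codeLow false _       _      = z₀
codeHigh _     _       peak = z₁
codeHigh true  inside  _    = z₁
codeHigh true  outside _    = z₃
codeHigh false _       _    = z₃

readLow readHigh : Fin 4 → Kind
readLow z₂ = valley
readLow _  = joint
readHigh z₁ = peak
readHigh _  = joint

readLow-lower : ∀ z → Lower (readLow z)
readLow-lower z₀ = joint
readLow-lower z₁ = joint
readLow-lower z₂ = valley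
readLow-lower z₃ = joint

readHigh-upper : ∀ z → Upper (readHigh z)
readHigh-upper z₀ = joint
readHigh-upper z₁ = peak
readHigh-upper z₂ = joint
readHigh-upper z₃ = joint

-- A single edge may go to any arrow of the zigzag, as the flags dictate. The flags both being false
-- would ask for an arrow from 0 to 3, which the hypothesis excludes.
code-⟶ : ∀ b b′ {s κ κ′} → (b ≡ false → b′ ≡ true) → Arc s κ κ′ → codeLow b s κ ⟶ᶻ codeHigh b′ s κ′
code-⟶ true  true  _  straight = against z₁ refl
code-⟶ true  false _  straight = along z₂ refl
code-⟶ false true  _  straight = along z₀ refl
code-⟶ false false b  straight = contradiction (b refl) λ ()
code-⟶ true  _     _  rise     = along z₀ refl
code-⟶ false _     _  rise     = along z₀ refl
code-⟶ _     _     _  fall     = against z₁ refl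
code-⟶ _     true  _  climb    = along z₂ refl
code-⟶ _     false _  climb    = along z₂ refl

read-arc : ∀ {x y} → x ⟶ᶻ y → Arc outside (readLow x) (readHigh y)
read-arc (along z₀ _)    = rise
read-arc (along z₁ ())
read-arc (along z₂ _)    = climb
read-arc (against z₀ ())
read-arc (against z₁ _)  = fall
read-arc (against z₂ ())

-- Takes the place of the height for tuples that mix peaks and valleys at one level, spreading them
-- so that `bit` and `decide` apply.
rank : Kind → ℕ
rank peak   = 0
rank joint  = 1
rank valley = 2

-- The extended operation and preservation of edges

module Extension (𝔸 : Structure) (fin : IsFinite 𝔸) where
  open Coordinates 𝔸 fin
  open Choices 𝔸 fin
  open Picking 𝔸 fin

  Has : Kind → List Vertex → Set
  Has κ S = Any (λ s → kindOf s ≡ κ) S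

  has? : ∀ κ S → Dec (Has κ S)
  has? κ S = any? (λ s → kindOf s ≟ᵏ κ) S

  level? : ∀ S → Dec (lowest heightOf S ≡ highest heightOf S)
  level? S = lowest heightOf S ℕ.≟ highest heightOf S

  data Mode : Set where
    low high scattered : Mode

  data ModeView (S : List Vertex) : Mode → Set where
    low      : lowest heightOf S ≡ highest heightOf S → ¬ Has peak S → ModeView S low
    high     : lowest heightOf S ≡ highest heightOf S → Has peak S → ¬ Has valley S → ModeView S high
    byKind   : lowest heightOf S ≡ highest heightOf S → Has peak S → Has valley S → ModeView S scattered
    byHeight : lowest heightOf S ≢ highest heightOf S → ModeView S scattered

  mode : ∀ S → ∃ (ModeView S)
  mode S with level? S | has? peak S | has? valley S
  ... | no ¬l | _     | _     = _ , byHeight ¬l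
  ... | yes l | no ¬p | _     = _ , low l ¬p
  ... | yes l | yes p | no ¬v = _ , high l p ¬v
  ... | yes l | yes p | yes v = _ , byKind l p v

  lowCode highCode : List Vertex → Vertex → Fin 4
  lowCode  S u = codeLow  (does (has? valley S)) (sideAbove u) (kindOf u)
  highCode S u = codeHigh (does (has? peak S))   (sideBelow u) (kindOf u)

  bit : (Vertex → ℕ) → List Vertex → Vertex → Fin 4
  bit h S u = if does (h u ℕ.≟ lowest h S) then z₀ else z₂

  lowPart highPart : (Vertex → ℕ) → List Vertex → List Vertex
  lowPart  h S = filter (λ s → h s ℕ.≟ lowest h S) S
  highPart h S = filter (λ s → h s ℕ.≟ highest h S) S

  decide : (Vertex → ℕ) → List Vertex → Fin 4 → Vertex
  decide h S zero    = pickLow (lowPart h S)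
  decide h S (suc _) = pickHigh (highPart h S)

  module _ {m} (fA : Operation m Carrier) (poly : IsPolymorphism 𝔸 fA) (fZ : Operation m (Fin 4)) where

    onTuples : Operation m Tuple
    onTuples rs = fA ✴ map value rs , [ product⁺ arity (λ i →
      subst (relation i) (sym (block-✴ arity i fA (map value rs)))
        (poly i (map (block arity i) (map value rs)) (All.lookup⁻ λ j →
          subst (relation i) (sym (trans (Vec.lookup-map j _ (map value rs)) (cong (block arity i) (Vec.lookup-map j value rs))))
            (product⁻ arity (tuple-∈ (lookup rs j)) i)))) ]

    entry-onTuples : ∀ l rs → entry l (onTuples rs) ≡ fA (map (entry l) rs)
    entry-onTuples l rs = trans (lookup-✴ fA (map value rs) l) (cong fA (sym (Vec.map-∘ _ value rs)))

    extendAs : ∀ {S μ} → ModeView S μ → Vec Vertex m → Vertex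
    extendAs {S} (low _ _)    us = node (fA (map elementOf us)) (onTuples (map tupleOf us)) (lowest heightOf S)
                                     (readLow (fZ (map (lowCode S) us)))
    extendAs {S} (high _ _ _) us = node (fA (map elementOf us)) (onTuples (map tupleOf us)) (lowest heightOf S)
                                     (readHigh (fZ (map (highCode S) us)))
    extendAs {S} (byKind _ _ _) us = decide (rank ∘ kindOf) S (fZ (map (bit (rank ∘ kindOf) S) us))
    extendAs {S} (byHeight _)   us = decide heightOf S (fZ (map (bit heightOf S) us))

    extend : Operation m Vertex
    extend us = extendAs (proj₂ (mode (entries us))) us

    -- By contraposition: if every element equals the l-th entry of its tuple, then applying `fA` to
    -- these equal vectors gives the same equality for the images.
    outside-onTuples : ∀ as rs h → side (sides (fA as) (onTuples rs)) h ≡ outside →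
                       ∃[ i ] side (sides (lookup as i) (lookup rs i)) h ≡ outside
    outside-onTuples as rs zero    ()
    outside-onTuples as rs (suc h) out
      with l , refl , out′ ← side-outside (agreement (fA as) (onTuples rs)) h out
      with i , a≢r ← Fin.¬∀⟶∃¬ m _ (λ i → lookup as i ≟ entry l (lookup rs i)) (λ all →
        agreement-outside (fA as) (onTuples rs) l out′ (trans
          (cong fA (lookup-ext λ i → trans (all i) (sym (Vec.lookup-map i (entry l) rs))))
          (sym (entry-onTuples l rs))))
      = i , trans (side-lookup (agreement (lookup as i) (lookup rs i)) l)
              (trans (Vec.lookup-map l _ (value (lookup rs i))) (dec-false (lookup as i ≟ _) a≢r))

    module _ (fZ-pres : Preserves {E = _⟶ᶻ_} fZ) (fZ-idem : ∀ z → fZ (replicate m z) ≡ z) (i₀ : Fin m)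
             (us vs : Vec Vertex m) (es : ∀ i → lookup us i ⟶ lookup vs i) where

      S T : List Vertex
      S = entries us
      T = entries vs

      C : Cover Step S T
      C = entries-cover us vs es

      step : ∀ i → Step (lookup us i) (lookup vs i)
      step i = ⟶⇒Step (es i)

      s₀∈ : lookup us i₀ ∈ˡ S
      s₀∈ = entries⁺ us i₀

      lowest-T : lowest heightOf T ≡ suc (lowest heightOf S)
      lowest-T = lowest-cover C heightOf rises s₀∈

      highest-T : highest heightOf T ≡ suc (highest heightOf S)
      highest-T = highest-cover C heightOf rises s₀∈

      no-peak : ¬ Has peak S
      no-peak has with find has
      ... | s , s∈ , eq with () ← subst Lower eq (lower (arc (proj₂ (proj₂ (C .Cover.forth s∈)))))

      no-valley : ¬ Has valley T
      no-valley has with find has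
      ... | t , t∈ , eq with () ← subst Upper eq (upper (arc (proj₂ (proj₂ (C .Cover.back t∈)))))

      highest≤ : highest heightOf S ≤ suc K
      highest≤ = let _ , s∈ , eq = highest-∈ heightOf s₀∈ in
        subst (_≤ suc K) eq (below (proj₂ (proj₂ (C .Cover.forth s∈))))

      -- The lowest level is strictly below the highest, which is at most K + 1 since S consists of
      -- sources. So edges from the lowest entries do not end in R, and edges from the highest do
      -- not start in A.
      scattered-⟶ : lowest heightOf S ≢ highest heightOf S → ∀ {x y} → x ≡ y →
                    decide heightOf S x ⟶ decide heightOf T y
      scattered-⟶ l≢h {zero} refl = let _ , s∈ , eq = lowest-∈ heightOf s₀∈ in pickLow-⟶ heights part (∈-filter⁺ _ s∈ eq)
        (ℕ.≤-trans (ℕ.≤∧≢⇒< (ℕ.≤-trans (lowest-≤ heightOf s₀∈) (highest-≥ heightOf s₀∈)) l≢h) highest≤)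
        where
        heights : ∀ {s} → s ∈ˡ lowPart heightOf S → heightOf s ≡ lowest heightOf S
        heights s∈ = proj₂ (∈-filter⁻ _ {xs = S} s∈)
        part : Cover Step (lowPart heightOf S) (lowPart heightOf T)
        part = filter-cover C _ _
          (λ _ _ st eq → trans (rises st) (trans (cong suc eq) (sym lowest-T)))
          (λ _ _ st eq → ℕ.suc-injective (trans (sym (rises st)) (trans eq lowest-T)))
      scattered-⟶ l≢h {suc _} refl = let _ , s∈ , eq = highest-∈ heightOf s₀∈ in pickHigh-⟶ heights part (∈-filter⁺ _ s∈ eq)
        (ℕ.m<n⇒n≢0 (ℕ.≤∧≢⇒< (ℕ.≤-trans (lowest-≤ heightOf s₀∈) (highest-≥ heightOf s₀∈)) l≢h))
        where
        heights : ∀ {s} → s ∈ˡ highPart heightOf S → heightOf s ≡ highest heightOf S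
        heights s∈ = proj₂ (∈-filter⁻ _ {xs = S} s∈)
        part : Cover Step (highPart heightOf S) (highPart heightOf T)
        part = filter-cover C _ _
          (λ _ _ st eq → trans (rises st) (trans (cong suc eq) (sym highest-T)))
          (λ _ _ st eq → ℕ.suc-injective (trans (sym (rises st)) (trans eq highest-T)))

      bits : map (bit heightOf S) us ≡ map (bit heightOf T) vs
      bits = lookup-ext λ i → trans (Vec.lookup-map i _ us) (trans
        (cong₂ (λ h l → if does (h ℕ.≟ l) then z₀ else z₂) (sym (rises (step i))) (sym lowest-T))
        (sym (Vec.lookup-map i _ vs)))

      module _ (l≡h : lowest heightOf S ≡ highest heightOf S) where

        h : ℕ
        h = lowest heightOf S

        heights : ∀ i → heightOf (lookup us i) ≡ h
        heights i = level heightOf l≡h (entries⁺ us i)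

        code-edges : ∃[ i ] gap (lookup us i) (lookup vs i) ≡ outside →
                     ∀ i → lookup (map (lowCode S) us) i ⟶ᶻ lookup (map (highCode T) vs) i
        code-edges (j , out) i = subst₂ _⟶ᶻ_ (sym (Vec.lookup-map i _ us)) (sym (Vec.lookup-map i _ vs))
          (subst₂ (λ s t → codeLow _ s (kindOf (lookup us i)) ⟶ᶻ codeHigh _ t (kindOf (lookup vs i)))
            (gap-sideAbove (step i)) (gap-sideBelow (step i))
            (code-⟶ (does (has? valley S)) (does (has? peak T)) flags (arc (step i))))
          where
          flags : does (has? valley S) ≡ false → does (has? peak T) ≡ true
          -- The arrow on the zigzag of entry j starts at a valley or ends at a peak, so one of the
          -- flags is set.
          flags eq = turn refl refl (subst (λ s → Arc s _ _) out (arc (step j)))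
            where
            turn : ∀ {κ κ′} → kindOf (lookup us j) ≡ κ → kindOf (lookup vs j) ≡ κ′ →
                   Arc outside κ κ′ → does (has? peak T) ≡ true
            turn _ k′ rise  = dec-true (has? peak T) (lose (entries⁺ vs j) k′)
            turn k _  fall  = contradiction (lose (entries⁺ us j) k) (does⁻-no (has? valley S) eq)
            turn k _  climb = contradiction (lose (entries⁺ us j) k) (does⁻-no (has? valley S) eq)

        -- If the segment of the image is a zigzag, then so is the segment of some argument; this
        -- makes the codes adjacent in every coordinate, and `fZ` preserves that. Over a single edge
        -- the kinds impose nothing.
        level-⟶ : node (fA (map elementOf us)) (onTuples (map tupleOf us)) h
                    (readLow (fZ (map (lowCode S) us))) ⟶
                  node (fA (map elementOf vs)) (onTuples (map tupleOf vs)) (suc h)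
                    (readHigh (fZ (map (highCode T) vs)))
        level-⟶ = nodes-⟶ (subst (_≤ suc K) (heights i₀) (below (step i₀)))
          (readLow-lower _) (readHigh-upper _)
          (λ out → let i , out′ = outside-onTuples (map elementOf us) (map tupleOf vs) h out in
            read-arc (fZ-pres _ _ (code-edges (i , trans
              (cong₂ side (cong₂ sides (sym (Vec.lookup-map i elementOf us)) (sym (Vec.lookup-map i tupleOf vs))) (heights i))
              out′))))
          (λ h≢ → cong fA (lookup-ext λ i → trans (Vec.lookup-map i elementOf us) (trans
            (sameElement (step i) (subst (_≤ suc K) (sym (rises (step i)))
              (ℕ.≤∧≢⇒< (below (step i)) (h≢ ∘ trans (sym (heights i))))))
            (sym (Vec.lookup-map i elementOf vs)))))
          (λ h≢ → cong onTuples (lookup-ext {xs = map tupleOf us} {map tupleOf vs} λ i → trans (Vec.lookup-map i tupleOf us) (trans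
            (sameTuple (step i) (h≢ ∘ trans (sym (heights i))))
            (sym (Vec.lookup-map i tupleOf vs)))))

        constant-codes : ∀ (c : Vertex → Fin 4) z → (∀ i → c (lookup vs i) ≡ z) → fZ (map c vs) ≡ z
        constant-codes c z eq = trans (cong fZ (lookup-ext λ i →
          trans (Vec.lookup-map i c vs) (trans (eq i) (sym (Vec.lookup-replicate i z))))) (fZ-idem z)

        -- A tuple of joints is always read as one of lower ends, also where it is
        -- the target of an edge; idempotency makes the two readings agree.
        read-joints : ¬ Has peak T → readLow (fZ (map (lowCode T) vs)) ≡ readHigh (fZ (map (highCode T) vs))
        read-joints ¬p = trans
          (cong readLow (constant-codes (lowCode T) z₀ λ i → low-joint i))
          (sym (cong readHigh (constant-codes (highCode T) z₃ λ i → high-joint i)))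
          where
          all-joint : ∀ i → kindOf (lookup vs i) ≡ joint
          all-joint i with kindOf (lookup vs i) in eq
          ... | joint  = refl
          ... | peak   = contradiction (lose (entries⁺ vs i) eq) ¬p
          ... | valley = contradiction (lose (entries⁺ vs i) eq) no-valley
          low-joint : ∀ i → lowCode T (lookup vs i) ≡ z₀
          low-joint i rewrite dec-false (has? valley T) no-valley | all-joint i = refl
          high-joint : ∀ i → highCode T (lookup vs i) ≡ z₃
          high-joint i rewrite dec-false (has? peak T) ¬p | all-joint i = refl

      level-T : lowest heightOf S ≡ highest heightOf S → lowest heightOf T ≡ highest heightOf T
      level-T l≡h = trans lowest-T (trans (cong suc l≡h) (sym highest-T))

      level-S : lowest heightOf T ≡ highest heightOf T → lowest heightOf S ≡ highest heightOf S
      level-S l≡h = ℕ.suc-injective (trans (sym lowest-T) (trans l≡h highest-T))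

      raise : ∀ {a r κ κ′} {u : Vertex} → κ ≡ κ′ → u ⟶ node a r (suc (lowest heightOf S)) κ′ →
              u ⟶ node a r (lowest heightOf T) κ
      raise {a} {r} {κ} {u = u} refl = subst (λ h → u ⟶ node a r h κ) (sym lowest-T)

      -- Sources contain no peaks and targets no valleys, so a level tuple mixing the two is on no
      -- edge at all. Heights shift by one, so S and T are level together.
      extendAs-⟶ : ∀ {μ ν} (x : ModeView S μ) (y : ModeView T ν) → extendAs x us ⟶ extendAs y vs
      extendAs-⟶ (byHeight l≢h) (byHeight _)     = scattered-⟶ l≢h (cong fZ bits)
      extendAs-⟶ (byHeight l≢h) (low l≡h _)      = contradiction (level-S l≡h) l≢h
      extendAs-⟶ (byHeight l≢h) (high l≡h _ _)   = contradiction (level-S l≡h) l≢h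
      extendAs-⟶ (byHeight l≢h) (byKind l≡h _ _) = contradiction (level-S l≡h) l≢h
      extendAs-⟶ (high _ p _)   _                = contradiction p no-peak
      extendAs-⟶ (byKind _ p _) _                = contradiction p no-peak
      extendAs-⟶ (low l≡h _)    (byHeight l≢h)   = contradiction (level-T l≡h) l≢h
      extendAs-⟶ (low l≡h _)    (byKind _ _ v)   = contradiction v no-valley
      extendAs-⟶ (low l≡h _)    (high _ _ _)     = raise refl (level-⟶ l≡h)
      extendAs-⟶ (low l≡h _)    (low _ ¬p)       = raise (read-joints l≡h ¬p) (level-⟶ l≡h)

    extend-preserves : Preserves {E = _⟶ᶻ_} fZ → (∀ z → fZ (replicate m z) ≡ z) → Fin m →
                       Preserves {E = _⟶_} extend
    extend-preserves fZ-pres fZ-idem i₀ us vs es = extendAs-⟶ fZ-pres fZ-idem i₀ us vs es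
      (proj₂ (mode (entries us))) (proj₂ (mode (entries vs)))

-- Transfer of identities to the extended operations

vertexAt-readLow : ∀ {n} (I : Vec Side n) h b κ → κ ≢ peak →
                   vertexAt I h (readLow (codeLow b (side I h) κ)) ≡ vertexAt I h κ
vertexAt-readLow I h b     peak   ≢peak = contradiction refl ≢peak
vertexAt-readLow I h b     valley _     = refl
vertexAt-readLow I h false joint  _     = refl
vertexAt-readLow I h true  joint  _ with side I h in eq
... | inside  = vertexAt-valley I h eq
... | outside = refl

vertexAt-readHigh : ∀ {n} (I : Vec Side n) h b κ → κ ≢ valley →
                    vertexAt I (suc h) (readHigh (codeHigh b (side I h) κ)) ≡ vertexAt I (suc h) κ
vertexAt-readHigh I h b     valley ≢valley = contradiction refl ≢valley
vertexAt-readHigh I h b     peak   _       = refl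
vertexAt-readHigh I h false joint  _       = refl
vertexAt-readHigh I h true  joint  _ with side I h in eq
... | inside  = vertexAt-peak I h eq
... | outside = refl

module Transfer (𝔸 : Structure) (fin : IsFinite 𝔸) where
  open Coordinates 𝔸 fin
  open Choices 𝔸 fin
  open Picking 𝔸 fin
  open Extension 𝔸 fin

  -- The common shape of the sides of a linear identity: an operation given on A and on the zigzag,
  -- applied to variables. A bare variable becomes the unary identity.
  record Combined : Set where
    field
      {size′}      : ℕ
      opᴬ          : Operation size′ Carrier
      polymorphism : IsPolymorphism 𝔸 opᴬ
      opᶻ          : Operation size′ (Fin 4)
      args         : Vec ℕ size′

    evalᴬ : (ℕ → Carrier) → Carrier
    evalᴬ ρ = opᴬ (map ρ args)

    evalᶻ : (ℕ → Fin 4) → Fin 4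
    evalᶻ ρ = opᶻ (map ρ args)

    evalᴰ : (ℕ → Vertex) → Vertex
    evalᴰ ρ = extend opᴬ polymorphism opᶻ (map ρ args)

    evalᴿ : (ℕ → Tuple) → Tuple
    evalᴿ ρ = onTuples opᴬ polymorphism opᶻ (map ρ args)

    evalᴬ-map : ∀ {X : Set} (c : X → Carrier) ρ → opᴬ (map c (map ρ args)) ≡ evalᴬ (c ∘ ρ)
    evalᴬ-map c ρ = cong opᴬ (sym (Vec.map-∘ c ρ args))

    evalᶻ-map : ∀ {X : Set} (c : X → Fin 4) ρ → opᶻ (map c (map ρ args)) ≡ evalᶻ (c ∘ ρ)
    evalᶻ-map c ρ = cong opᶻ (sym (Vec.map-∘ c ρ args))

    entry-evalᴿ : ∀ l ρ → entry l (evalᴿ ρ) ≡ evalᴬ (entry l ∘ ρ)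
    entry-evalᴿ l ρ = trans (entry-onTuples opᴬ polymorphism opᶻ l (map ρ args)) (evalᴬ-map (entry l) ρ)

  open Combined

  infix 4 _≐_ _⊑_
  record _≐_ (p q : Combined) : Set where
    constructor _,_
    field
      eqᴬ : ∀ ρ → evalᴬ p ρ ≡ evalᴬ q ρ
      eqᶻ : ∀ ρ → evalᶻ p ρ ≡ evalᶻ q ρ
  open _≐_

  record Projects (p : Combined) (z : ℕ) : Set where
    constructor _,_
    field
      projᴬ : ∀ ρ → evalᴬ p ρ ≡ ρ z
      projᶻ : ∀ ρ → evalᶻ p ρ ≡ ρ z
  open Projects

  OccursIn : ∀ p q → Fin (size′ p) → Set
  OccursIn p q i = ∃[ j ] lookup (args q) j ≡ lookup (args p) i

  occurs-in? : ∀ p q → Decidable (OccursIn p q)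
  occurs-in? p q i = Fin.any? λ j → lookup (args q) j ℕ.≟ lookup (args p) i

  _⊑_ : Combined → Combined → Set
  p ⊑ q = ∀ i → OccursIn p q i

  occurs : ∀ p q (ρ : ℕ → Vertex) → p ⊑ q → ∀ i → ∃[ j ] lookup (map ρ (args q)) j ≡ lookup (map ρ (args p)) i
  occurs p q ρ p⊑q i = let j , eq = p⊑q i in
    j , trans (Vec.lookup-map j ρ (args q)) (trans (cong ρ eq) (sym (Vec.lookup-map i ρ (args p))))

  node-cong : ∀ h {a a′ r r′ κ κ′} → a ≡ a′ → r ≡ r′ → κ ≡ κ′ → node a r h κ ≡ node a′ r′ h κ′
  node-cong h refl refl refl = refl

  module _ {p q : Combined} (p≐q : p ≐ q) (ρ : ℕ → Vertex) where

    evalᴿ-≐ : ∀ σ → evalᴿ p σ ≡ evalᴿ q σ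
    evalᴿ-≐ σ = value-injective (lookup-ext λ l →
      trans (entry-evalᴿ p l σ) (trans (eqᴬ p≐q (entry l ∘ σ)) (sym (entry-evalᴿ q l σ))))

    element-≐ : opᴬ p (map elementOf (map ρ (args p))) ≡ opᴬ q (map elementOf (map ρ (args q)))
    element-≐ = trans (evalᴬ-map p elementOf ρ) (trans (eqᴬ p≐q _) (sym (evalᴬ-map q elementOf ρ)))

    tuple-≐ : onTuples _ (polymorphism p) (opᶻ p) (map tupleOf (map ρ (args p))) ≡
              onTuples _ (polymorphism q) (opᶻ q) (map tupleOf (map ρ (args q)))
    tuple-≐ = trans (cong (onTuples _ (polymorphism p) (opᶻ p)) (sym (Vec.map-∘ tupleOf ρ (args p))))
      (trans (evalᴿ-≐ (tupleOf ∘ ρ)) (cong (onTuples _ (polymorphism q) (opᶻ q)) (Vec.map-∘ tupleOf ρ (args q))))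

    code-≐ : ∀ (c : Vertex → Fin 4) → opᶻ p (map c (map ρ (args p))) ≡ opᶻ q (map c (map ρ (args q)))
    code-≐ c = trans (evalᶻ-map p c ρ) (trans (eqᶻ p≐q _) (sym (evalᶻ-map q c ρ)))

    extendAs-≐ : ∀ {S μ} (x : ModeView S μ) →
                 extendAs _ (polymorphism p) (opᶻ p) x (map ρ (args p)) ≡
                 extendAs _ (polymorphism q) (opᶻ q) x (map ρ (args q))
    extendAs-≐ {S} (low _ _)      = node-cong (lowest heightOf S) element-≐ tuple-≐ (cong readLow (code-≐ (lowCode S)))
    extendAs-≐ {S} (high _ _ _)   = node-cong (lowest heightOf S) element-≐ tuple-≐ (cong readHigh (code-≐ (highCode S)))
    extendAs-≐ {S} (byKind _ _ _) = cong (decide (rank ∘ kindOf) S) (code-≐ (bit (rank ∘ kindOf) S))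
    extendAs-≐ {S} (byHeight _)   = cong (decide heightOf S) (code-≐ (bit heightOf S))

    -- Equal sets of entries give the same list and hence the same mode. Within a mode the
    -- operations act through A and the zigzag only, where the two sides agree.
    balanced : p ⊑ q → q ⊑ p → evalᴰ p ρ ≡ evalᴰ q ρ
    balanced p⊑q q⊑p = trans (extendAs-≐ (proj₂ (mode (entries (map ρ (args p))))))
      (cong (λ S → extendAs _ (polymorphism q) (opᶻ q) (proj₂ (mode S)) (map ρ (args q)))
        (entries-cong (map ρ (args p)) (map ρ (args q)) (occurs p q ρ p⊑q) (occurs q p ρ q⊑p)))

  -- A projection returns a code unchanged, so codes must read back as the vertex. A joint is
  -- recoded as a valley only below a single edge, where the two coincide.
  lowCode-node : ∀ b u → kindOf u ≢ peak →
                 node (elementOf u) (tupleOf u) (heightOf u) (readLow (codeLow b (sideAbove u) (kindOf u))) ≡ u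
  lowCode-node b u ≢peak = trans
    (cong (place (elementOf u) (tupleOf u))
      (vertexAt-readLow (sides (elementOf u) (tupleOf u)) (heightOf u) b (kindOf u) ≢peak))
    (node-coordinates u)

  highCode-node : ∀ b u → kindOf u ≢ valley →
                  node (elementOf u) (tupleOf u) (heightOf u) (readHigh (codeHigh b (sideBelow u) (kindOf u))) ≡ u
  highCode-node b u ≢valley = trans
    (cong (place (elementOf u) (tupleOf u)) (at (heightOf u)))
    (node-coordinates u)
    where
    at : ∀ h → vertexAt (sides (elementOf u) (tupleOf u)) h
                 (readHigh (codeHigh b (side (sides (elementOf u) (tupleOf u)) (h ∸ 1)) (kindOf u))) ≡
               vertexAt (sides (elementOf u) (tupleOf u)) h (kindOf u)
    -- Paths begin with a single edge, so every kind at level 0 names the initial vertex.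
    at zero    = refl
    at (suc h) = vertexAt-readHigh (sides (elementOf u) (tupleOf u)) h b (kindOf u) ≢valley

  pickLow-constant : ∀ {S c} → c ∈ˡ S → (∀ {s} → s ∈ˡ S → s ≡ c) → pickLow S ≡ c
  pickLow-constant {S} c∈ const =
    let _ , s∈ = slice-nonempty elements elementOf c∈ ; _ , s∈′ = slice-nonempty tuples tupleOf s∈ in
    pick-constant s∈′ λ t∈ → const (proj₁ (slice⁻ elements elementOf {S = S} (proj₁ (slice⁻ tuples tupleOf t∈))))

  pickHigh-constant : ∀ {S c} → c ∈ˡ S → (∀ {s} → s ∈ˡ S → s ≡ c) → pickHigh S ≡ c
  pickHigh-constant {S} c∈ const =
    let _ , s∈ = slice-nonempty tuples tupleOf c∈ ; _ , s∈′ = slice-nonempty elements elementOf s∈ in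
    pick-constant s∈′ λ t∈ → const (proj₁ (slice⁻ tuples tupleOf {S = S} (proj₁ (slice⁻ elements elementOf t∈))))

  module _ {S c d} (h : Vertex → ℕ) (l≢h : lowest h S ≢ highest h S)
           (c∈ : c ∈ˡ S) (pair : ∀ {s} → s ∈ˡ S → s ≡ c ⊎ s ≡ d) where

    -- If d were lowest as well, all entries would be level; so c is alone in the lowest part.
    decide-low : h c ≡ lowest h S → pickLow (lowPart h S) ≡ c
    decide-low hc = pickLow-constant (∈-filter⁺ (λ s → h s ℕ.≟ lowest h S) c∈ hc) λ s∈ →
      let s∈S , hs = ∈-filter⁻ (λ s → h s ℕ.≟ lowest h S) {xs = S} s∈ in go (pair s∈S) hs
      where
      go : ∀ {s} → s ≡ c ⊎ s ≡ d → h s ≡ lowest h S → s ≡ c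
      go (inj₁ s≡c)  _  = s≡c
      go (inj₂ refl) hd with t , t∈ , ht ← highest-∈ h c∈ with pair t∈
      ... | inj₁ refl = contradiction (trans (sym hc) ht) l≢h
      ... | inj₂ refl = contradiction (trans (sym hd) ht) l≢h

    -- Now d has to be the lowest entry, which leaves c alone in the highest part.
    decide-high : h c ≢ lowest h S → pickHigh (highPart h S) ≡ c
    decide-high hc = pickHigh-constant (∈-filter⁺ (λ s → h s ℕ.≟ highest h S) c∈ hc′) λ s∈ →
      let s∈S , hs = ∈-filter⁻ (λ s → h s ℕ.≟ highest h S) {xs = S} s∈ in go (pair s∈S) hs
      where
      hd : h d ≡ lowest h S
      hd with t , t∈ , ht ← lowest-∈ h c∈ with pair t∈
      ... | inj₁ refl = contradiction ht hc
      ... | inj₂ refl = ht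
      hc′ : h c ≡ highest h S
      hc′ with t , t∈ , ht ← highest-∈ h c∈ with pair t∈
      ... | inj₁ refl = ht
      ... | inj₂ refl = contradiction (trans (sym hd) ht) l≢h
      go : ∀ {s} → s ≡ c ⊎ s ≡ d → h s ≡ highest h S → s ≡ c
      go (inj₁ s≡c)  _  = s≡c
      go (inj₂ refl) hs = contradiction (trans (sym hd) hs) l≢h

    decide-bit : decide h S (bit h S c) ≡ c
    decide-bit = go (h c ℕ.≟ lowest h S)
      where
      branch : Bool → Vertex
      branch b = decide h S (if b then z₀ else z₂)
      go : Dec (h c ≡ lowest h S) → decide h S (bit h S c) ≡ c
      go (yes eq) = trans (cong branch (dec-true (h c ℕ.≟ lowest h S) eq)) (decide-low eq)
      go (no ne)  = trans (cong branch (dec-false (h c ℕ.≟ lowest h S) ne)) (decide-high ne)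

  module _ {p z w} (proj : Projects p z) (two : ∀ i → lookup (args p) i ≡ z ⊎ lookup (args p) i ≡ w) where

    -- Otherwise moving z from vertex 0 to vertex 1 of the zigzag would not change the result. The
    -- zigzag is used because A may have a single element.
    z-occurs : ∃[ i ] lookup (args p) i ≡ z
    z-occurs with Fin.any? (λ i → lookup (args p) i ℕ.≟ z)
    ... | yes occ = occ
    ... | no ¬occ = contradiction
      (trans (sym (projᶻ proj (λ _ → z₀))) (trans (cong (opᶻ p) same) (trans (projᶻ proj mark) marked))) λ ()
      where
      mark : ℕ → Fin 4
      mark x = if does (x ℕ.≟ z) then z₁ else z₀
      marked : mark z ≡ z₁
      marked rewrite dec-true (z ℕ.≟ z) refl = refl
      same : map (λ _ → z₀) (args p) ≡ map mark (args p)
      same = lookup-ext λ i → trans (Vec.lookup-map i _ (args p)) (trans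
        (cong (λ b → if b then z₁ else z₀) (sym (dec-false (lookup (args p) i ℕ.≟ z) λ eq → ¬occ (i , eq))))
        (sym (Vec.lookup-map i mark (args p))))

    module _ (ρ : ℕ → Vertex) where

      c : Vertex
      c = ρ z

      -- The operations return the coordinates and the code of c. For level tuples these read back
      -- as c; for scattered ones the two possible entries lie in different parts, and the code
      -- selects the part of c.
      extendAs-projects : ∀ {S μ} (x : ModeView S μ) → c ∈ˡ S → (∀ {s} → s ∈ˡ S → s ≡ c ⊎ s ≡ ρ w) →
                          extendAs _ (polymorphism p) (opᶻ p) x (map ρ (args p)) ≡ c
      extendAs-projects {S} x c∈ pair = go x
        where
        element-c : opᴬ p (map elementOf (map ρ (args p))) ≡ elementOf c
        element-c = trans (evalᴬ-map p elementOf ρ) (projᴬ proj _)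
        tuple-c : onTuples _ (polymorphism p) (opᶻ p) (map tupleOf (map ρ (args p))) ≡ tupleOf c
        tuple-c = value-injective (lookup-ext λ l → trans
          (entry-onTuples _ (polymorphism p) (opᶻ p) l (map tupleOf (map ρ (args p))))
          (trans (cong (opᴬ p) (sym (Vec.map-∘ (entry l) tupleOf (map ρ (args p)))))
          (trans (evalᴬ-map p (entry l ∘ tupleOf) ρ) (projᴬ proj _))))
        code-c : ∀ (f : Vertex → Fin 4) → opᶻ p (map f (map ρ (args p))) ≡ f c
        code-c f = trans (evalᶻ-map p f ρ) (projᶻ proj _)
        node-c : ∀ {a r h κ κ′} → a ≡ elementOf c → r ≡ tupleOf c → heightOf c ≡ h → κ ≡ κ′ →
                 node (elementOf c) (tupleOf c) (heightOf c) κ′ ≡ c → node a r h κ ≡ c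
        node-c refl refl refl refl eq = eq
        go : ∀ {μ} (x : ModeView S μ) → extendAs _ (polymorphism p) (opᶻ p) x (map ρ (args p)) ≡ c
        go (low l≡h ¬peak) = node-c element-c tuple-c (level heightOf l≡h c∈)
          (cong readLow (code-c (lowCode S)))
          (lowCode-node _ c λ eq → ¬peak (lose c∈ eq))
        go (high l≡h _ ¬valley) = node-c element-c tuple-c (level heightOf l≡h c∈)
          (cong readHigh (code-c (highCode S)))
          (highCode-node _ c λ eq → ¬valley (lose c∈ eq))
        go (byKind _ has-peak has-valley) = trans
          (cong (decide (rank ∘ kindOf) S) (code-c (bit (rank ∘ kindOf) S)))
          (decide-bit (rank ∘ kindOf) spread c∈ pair)
          where
          spread : lowest (rank ∘ kindOf) S ≢ highest (rank ∘ kindOf) S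
          spread eq with s , s∈ , s-peak ← find has-peak | t , t∈ , t-valley ← find has-valley =
            contradiction (subst₂ _≤_ (cong rank t-valley) (cong rank s-peak)
              (ℕ.≤-trans (highest-≥ (rank ∘ kindOf) t∈) (ℕ.≤-trans (ℕ.≤-reflexive (sym eq)) (lowest-≤ (rank ∘ kindOf) s∈))))
              λ ()
        go (byHeight l≢h) = trans
          (cong (decide heightOf S) (code-c (bit heightOf S))) (decide-bit heightOf l≢h c∈ pair)

      projects : evalᴰ p ρ ≡ ρ z
      projects = extendAs-projects (proj₂ (mode (entries (map ρ (args p)))))
        (let i , eq = z-occurs in
         subst (_∈ˡ entries _) (trans (Vec.lookup-map i ρ (args p)) (cong ρ eq)) (entries⁺ (map ρ (args p)) i))
        (λ s∈ → let i , eq = entries⁻ (map ρ (args p)) s∈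
                    eq′ = trans (sym eq) (Vec.lookup-map i ρ (args p)) in
          Sum.map (trans eq′ ∘ cong ρ) (trans eq′ ∘ cong ρ) (two i))

  record Idem (p : Combined) : Set where
    constructor _,_
    field
      idemᴬ : ∀ a → opᴬ p (replicate _ a) ≡ a
      idemᶻ : ∀ z → opᶻ p (replicate _ z) ≡ z
  open Idem

  constant-projects : ∀ {p z} → Idem p → (∀ i → lookup (args p) i ≡ z) → Projects p z
  constant-projects {p} {z} idem const =
    (λ ρ → trans (cong (opᴬ p) (flat ρ)) (idemᴬ idem _)) ,
    (λ ρ → trans (cong (opᶻ p) (flat ρ)) (idemᶻ idem _))
    where
    flat : ∀ {X : Set} (ρ : ℕ → X) → map ρ (args p) ≡ replicate _ (ρ z)
    flat ρ = lookup-ext λ i → trans (Vec.lookup-map i ρ (args p))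
      (trans (cong ρ (const i)) (sym (Vec.lookup-replicate i _)))

  Within : ℕ → ℕ → Combined → Set
  Within x y p = ∀ i → lookup (args p) i ≡ x ⊎ lookup (args p) i ≡ y

  within-other : ∀ {x y a b : ℕ} → a ≡ x ⊎ a ≡ y → b ≡ x ⊎ b ≡ y → a ≢ b → ∀ {e} → e ≡ x ⊎ e ≡ y → e ≡ a ⊎ e ≡ b
  within-other (inj₁ refl) (inj₁ refl) a≢b _          = contradiction refl a≢b
  within-other (inj₁ refl) (inj₂ refl) _   e          = e
  within-other (inj₂ refl) (inj₁ refl) _   (inj₁ e≡x) = inj₂ e≡x
  within-other (inj₂ refl) (inj₁ refl) _   (inj₂ e≡y) = inj₁ e≡y
  within-other (inj₂ refl) (inj₂ refl) a≢b _          = contradiction refl a≢b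

  -- An unbalanced identity in two variables says that both sides are the same
  -- variable: one side involves only one variable and is idempotent.
  unbalanced : ∀ {p q x y} → p ≐ q → Idem q → Fin (size′ q) → Within x y p → Within x y q →
               ∃[ i ] (∀ j → lookup (args q) j ≢ lookup (args p) i) → ∀ ρ → evalᴰ p ρ ≡ evalᴰ q ρ
  unbalanced {p} {q} {x} {y} p≐q idem j₀ in-p in-q (i , fresh) ρ = trans
    (projects proj-p (λ i′ → other (in-p i′)) ρ)
    (sym (projects proj-q (λ j → other (in-q j)) ρ))
    where
    z = lookup (args q) j₀
    other : ∀ {e} → e ≡ x ⊎ e ≡ y → e ≡ z ⊎ e ≡ lookup (args p) i
    other = within-other (in-q j₀) (in-p i) (fresh j₀)
    proj-q : Projects q z
    proj-q = constant-projects idem λ j → [ id , (λ eq → contradiction eq (fresh j)) ]′ (other (in-q j))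
    proj-p : Projects p z
    proj-p = (λ σ → trans (eqᴬ p≐q σ) (projᴬ proj-q σ)) , (λ σ → trans (eqᶻ p≐q σ) (projᶻ proj-q σ))

  ⊑-or-fresh : ∀ p q → p ⊑ q ⊎ ∃[ i ] (∀ j → lookup (args q) j ≢ lookup (args p) i)
  ⊑-or-fresh p q with Fin.all? (occurs-in? p q)
  ... | yes p⊑q = inj₁ p⊑q
  ... | no ¬p⊑q = let i , ¬occ = Fin.¬∀⟶∃¬ _ (OccursIn p q) (occurs-in? p q) ¬p⊑q in
    inj₂ (i , λ j eq → ¬occ (j , eq))

  two-variables : ∀ {p q x y} → p ≐ q → Idem p → Idem q → Fin (size′ p) → Fin (size′ q) →
                  Within x y p → Within x y q → ∀ ρ → evalᴰ p ρ ≡ evalᴰ q ρ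
  two-variables {p} {q} p≐q idem-p idem-q i₀ j₀ in-p in-q ρ with ⊑-or-fresh p q | ⊑-or-fresh q p
  ... | inj₁ p⊑q   | inj₁ q⊑p   = balanced p≐q ρ p⊑q q⊑p
  ... | inj₂ fresh | _          = unbalanced p≐q idem-q j₀ in-p in-q fresh ρ
  ... | inj₁ _     | inj₂ fresh = sym (unbalanced
    ((λ σ → sym (eqᴬ p≐q σ)) , (λ σ → sym (eqᶻ p≐q σ))) idem-p i₀ in-q in-p fresh ρ)

-- Interpretation of the signature on 𝓓(𝔸)

lookup-∈ : ∀ {n} (xs : Vec ℕ n) i → lookup xs i ∈ˡ toList xs
lookup-∈ xs i = ∈-toList⁺ (∈-lookup i xs)

∈-lookup⁻ : ∀ {n} (xs : Vec ℕ n) {x} → x ∈ˡ toList xs → ∃[ i ] lookup xs i ≡ x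
∈-lookup⁻ xs x∈ = _ , sym (lookup-index (∈-toList⁻ {xs = xs} x∈))

projection-polymorphism : ∀ 𝔸 {m} (j : Fin m) → IsPolymorphism 𝔸 (λ as → lookup as j)
projection-polymorphism 𝔸 j i rs rs∈ = subst (Structure.relation 𝔸 i)
  (lookup-ext λ l → trans (sym (Vec.lookup-map j _ rs)) (sym (lookup-✴ _ rs l)))
  (All.lookup⁺ rs∈ j)

module Lifting {s ℓ} (𝔸 : Structure) (fin : IsFinite 𝔸) {𝑆 : Signature s} {Σ : Pred (Identity 𝑆) ℓ}
               (linear : Linear Σ) (idempotent : Idempotent Σ)
               (𝔸⊨Σ : 𝔸 ⊨ Σ) (zigzag⊨Σ : pathDigraph zigzag ⊨ Σ) where
  open Signature 𝑆
  open Coordinates 𝔸 fin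
  open Extension 𝔸 fin
  open Transfer 𝔸 fin
  open Combined
  open _≐_

  ⟦_⟧ᴬ : (f : Symbol) → Operation (symbolArity f) Carrier
  ⟦_⟧ᴬ = proj₁ 𝔸⊨Σ

  ⟦_⟧ᶻ : (f : Symbol) → Operation (symbolArity f) (Fin 4)
  ⟦_⟧ᶻ = proj₁ zigzag⊨Σ

  firstArgument : ∀ f → Fin (symbolArity f)
  firstArgument f = Fin.fromℕ< (>-nonZero⁻¹ _ {{arityPositive f}})

  Idempotentᶻ : Symbol → Set
  Idempotentᶻ f = ∀ z → ⟦ f ⟧ᶻ (replicate _ z) ≡ z

  idempotentᶻ? : ∀ f → Dec (Idempotentᶻ f)
  idempotentᶻ? f = Fin.all? λ z → ⟦ f ⟧ᶻ (replicate _ z) Fin.≟ z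

  -- Symbols that do not appear in Σ may be interpreted on the zigzag by operations that are not
  -- idempotent, and `extend-preserves` does not cover these. Idempotency on four vertices is
  -- decidable, while appearing in Σ need not be.
  lift : ∀ f → Dec (Idempotentᶻ f) → Operation (symbolArity f) Vertex
  lift f (yes _) = extend ⟦ f ⟧ᴬ (proj₁ (proj₂ 𝔸⊨Σ) f) ⟦ f ⟧ᶻ
  lift f (no _)  = λ us → lookup us (firstArgument f)

  lift-polymorphism : ∀ f d → IsPolymorphism (𝓓 𝔸 fin) (lift f d)
  lift-polymorphism f (yes idem) = preserves⇒polymorphism (extend-preserves _ _ _
    (polymorphism⇒preserves (proj₁ (proj₂ zigzag⊨Σ) f)) idem (firstArgument f))
  lift-polymorphism f (no _) = preserves⇒polymorphism λ _ _ es → es (firstArgument f)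

  ⟦_⟧ᴰ : (f : Symbol) → Operation (symbolArity f) Vertex
  ⟦ f ⟧ᴰ = lift f (idempotentᶻ? f)

  record Represents (u : Term 𝑆) (p : Combined) : Set s where
    field
      position  : Fin (size′ p)
      idem      : Idem p
      vars-args : vars u ≡ toList (args p)
      onᴬ       : ∀ ρ → eval ⟦_⟧ᴬ ρ u ≡ evalᴬ p ρ
      onᶻ       : ∀ ρ → eval ⟦_⟧ᶻ ρ u ≡ evalᶻ p ρ
      onᴰ       : ∀ ρ → eval ⟦_⟧ᴰ ρ u ≡ evalᴰ p ρ
  open Represents

  evalᵛ-replicate : ∀ {A : Set} (⟦_⟧ : (f : Symbol) → Operation (symbolArity f) A) ρ n x →
                    evalᵛ {𝑆 = 𝑆} ⟦_⟧ ρ (replicate n (var x)) ≡ replicate n (ρ x)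
  evalᵛ-replicate ⟦_⟧ ρ zero    x = refl
  evalᵛ-replicate ⟦_⟧ ρ (suc n) x = cong (ρ x ∷_) (evalᵛ-replicate ⟦_⟧ ρ n x)

  varsᵛ-variables : ∀ {n} (xs : Vec ℕ n) → varsᵛ {𝑆 = 𝑆} (map var xs) ≡ toList xs
  varsᵛ-variables []       = refl
  varsᵛ-variables (x ∷ xs) = cong (x ∷_) (varsᵛ-variables xs)

  lift-idempotent : ∀ f d → Idempotentᶻ f → lift f d ≡ extend ⟦ f ⟧ᴬ (proj₁ (proj₂ 𝔸⊨Σ) f) ⟦ f ⟧ᶻ
  lift-idempotent f (yes _)    _    = refl
  lift-idempotent f (no ¬idem) idem = contradiction idem ¬idem

  represent : ∀ {u} → Shallow u → (∀ {f} → f ∈ˡ symbols u → AppearsIn Σ f) → ∃ (Represents u)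
  represent (var x) _ = p , record
    { position  = zero
    ; idem      = (λ _ → refl) , (λ _ → refl)
    ; vars-args = refl
    ; onᴬ       = λ _ → refl
    ; onᶻ       = λ _ → refl
    -- The extension of the unary identity is again the identity, as the case of a projection with
    -- both variables equal.
    ; onᴰ       = λ ρ → sym (projects {p} {x} {x} ((λ _ → refl) , (λ _ → refl)) (λ { zero → inj₁ refl }) ρ)
    }
    where
    p : Combined
    p = record
      { opᴬ          = λ as → lookup as zero
      ; polymorphism = projection-polymorphism 𝔸 zero
      ; opᶻ          = λ zs → lookup zs zero
      ; args         = x ∷ []
      }
  represent (op f xs) appears = p , record
    { position  = firstArgument f
    ; idem      = (λ a → trans (cong ⟦ f ⟧ᴬ (sym (evalᵛ-replicate ⟦_⟧ᴬ (λ _ → a) _ x)))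
                    (proj₂ (proj₂ 𝔸⊨Σ) _ _ ∈Σ (λ _ → a)))
                , idemᶻ
    ; vars-args = varsᵛ-variables xs
    ; onᴬ       = λ ρ → cong ⟦ f ⟧ᴬ (evalᵛ-variables ⟦_⟧ᴬ ρ xs)
    ; onᶻ       = λ ρ → cong ⟦ f ⟧ᶻ (evalᵛ-variables ⟦_⟧ᶻ ρ xs)
    ; onᴰ       = λ ρ → trans (cong ⟦ f ⟧ᴰ (evalᵛ-variables ⟦_⟧ᴰ ρ xs))
                    (cong (λ g → g (map ρ xs)) (lift-idempotent f (idempotentᶻ? f) idemᶻ))
    }
    where
    p : Combined
    p = record
      { opᴬ          = ⟦ f ⟧ᴬ
      ; polymorphism = proj₁ (proj₂ 𝔸⊨Σ) f
      ; opᶻ          = ⟦ f ⟧ᶻ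
      ; args         = xs
      }
    x = proj₁ (idempotent f (appears (here refl)))
    ∈Σ = proj₂ (idempotent f (appears (here refl)))
    idemᶻ : Idempotentᶻ f
    idemᶻ z = trans (cong ⟦ f ⟧ᶻ (sym (evalᵛ-replicate ⟦_⟧ᶻ (λ _ → z) _ x)))
      (proj₂ (proj₂ zigzag⊨Σ) _ _ ∈Σ (λ _ → z))

  module _ {u v p q} (R : Represents u p) (R′ : Represents v q) where

    ⊆⇒⊑ : (∀ {x} → x ∈ˡ vars u → x ∈ˡ vars v) → p ⊑ q
    ⊆⇒⊑ u⊆v i = ∈-lookup⁻ (args q) (subst (_ ∈ˡ_) (vars-args R′)
      (u⊆v (subst (_ ∈ˡ_) (sym (vars-args R)) (lookup-∈ (args p) i))))

  within : ∀ {u p} (R : Represents u p) {x y} → vars u ⊆ x ∷ y ∷ [] → Within x y p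
  within {p = p} R u⊆ i with u⊆ (subst (_ ∈ˡ_) (sym (vars-args R)) (lookup-∈ (args p) i))
  ... | here eq         = inj₁ eq
  ... | there (here eq) = inj₂ eq

  holds : (∀ e → e ∈ Σ → Balanced e ⊎ AtMostTwoVariables e) →
          ∀ u v → (u ≈ v) ∈ Σ → ∀ ρ → eval ⟦_⟧ᴰ ρ u ≡ eval ⟦_⟧ᴰ ρ v
  holds condition u v ∈Σ ρ
    with p , R ← represent (shallow u (proj₁ (linear (u ≈ v) ∈Σ))) (λ f∈ → u , v , ∈Σ , ∈-++⁺ˡ f∈)
       | q , R′ ← represent (shallow v (proj₂ (linear (u ≈ v) ∈Σ))) (λ f∈ → u , v , ∈Σ , ∈-++⁺ʳ (symbols u) f∈)
    = trans (onᴰ R ρ) (trans (equal (condition (u ≈ v) ∈Σ)) (sym (onᴰ R′ ρ)))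
    where
    p≐q : p ≐ q
    p≐q = (λ σ → trans (sym (onᴬ R σ)) (trans (proj₂ (proj₂ 𝔸⊨Σ) u v ∈Σ σ) (onᴬ R′ σ))) ,
          (λ σ → trans (sym (onᶻ R σ)) (trans (proj₂ (proj₂ zigzag⊨Σ) u v ∈Σ σ) (onᶻ R′ σ)))
    equal : Balanced (u ≈ v) ⊎ AtMostTwoVariables (u ≈ v) → evalᴰ p ρ ≡ evalᴰ q ρ
    equal (inj₁ u∼v) = balanced p≐q ρ (⊆⇒⊑ R R′ (Equivalence.to u∼v)) (⊆⇒⊑ R′ R (Equivalence.from u∼v))
    equal (inj₂ (x , y , ⊆xy)) = two-variables p≐q (idem R) (idem R′) (position R) (position R′)
      (within R (⊆xy ∘ ∈-++⁺ˡ)) (within R′ (⊆xy ∘ ∈-++⁺ʳ (vars u))) ρ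

theorem5 : ∀ {s ℓ} (𝔸 : Structure) (fin : IsFinite 𝔸)
    (𝑆 : Signature s) (Σ : Pred (Identity 𝑆) ℓ) →
    Linear Σ → Idempotent Σ →
    pathDigraph zigzag ⊨ Σ →
    (∀ e → e ∈ Σ → Balanced e ⊎ AtMostTwoVariables e) →
    (𝓓 𝔸 fin ⊨ Σ) ⇔ (𝔸 ⊨ Σ)
theorem5 𝔸 fin 𝑆 Σ linear idempotent zigzag⊨Σ condition = mk⇔ (Restriction.restrict 𝔸 fin linear) λ 𝔸⊨Σ →
  let open Lifting 𝔸 fin linear idempotent 𝔸⊨Σ zigzag⊨Σ in
  ⟦_⟧ᴰ , (λ f → lift-polymorphism f (idempotentᶻ? f)) , holds condition
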